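{- For every positive integer $n$, let $$\overline{\mathfrak{M}_1}(n)=\{(\pi,\rho)\in \mathrm{Int}(n)\times \mathrm{NC}(n)\mid d_H(\pi,\rho)=n-1\}.$$ Then $$\left|\overline{\mathfrak{M}_1}(n)\right|=\sum_{m=1}^{n}\frac1n\binom{n}{m-1}\binom{n+m-1}{n-m}.$$ Moreover, for every $m\in\{1,\ldots,n\}$, the term of this sum indexed by $m$ is precisely the number of couples $(\pi,\rho)\in\overline{\mathfrak{M}_1}(n)$ such that $|\pi|=m$.
   Context: For a positive integer $n$, a partition $\pi$ of $\{1,\ldots,n\}$ is non-crossing if there are no two distinct blocks $V,W$ of $\pi$ and numbers $a<b<c<d$ with $a,c\in V$ and $b,d\in W$. $\mathrm{NC}(n)$ is the set of non-crossing partitions of $\{1,\ldots,n\}$, partially ordered by $\pi\le\rho$ iff every block of $\pi$ is contained in a block of $\rho$. $|\pi|$ is the number of blocks of $\pi$. The Hasse diagram $\mathcal{H}_n$ is the undirected graph with vertex set $\mathrm{NC}(n)$ in which $\pi_1,\pi_2$ are joined by an edge iff one of them covers the other in $(\mathrm{NC}(n),\le)$; $d_H(\pi,\rho)$ is the graph distance (length of a shortest path) in $\mathcal{H}_n$. $\mathrm{Int}(n)\subseteq\mathrm{NC}(n)$ is the set of interval partitions: those in which every block has the form $\{i\in\mathbb{N}\mid p\le i\le q\}$ for some $p\le q$ in $\{1,\ldots,n\}$. -}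

module Defs where

open import Algebra.Properties.Monoid.Sum using (sum)
open import Data.Fin.Base as Fin using (Fin; toℕ)
open import Data.Fin.Subset using (Subset; _∈_; _⊆_; _∩_; Empty; Nonempty)
open import Data.Integer.Base using (+_)
open import Data.List.Base using (List; length)
open import Data.List.Membership.Propositional using () renaming (_∈_ to _∈ₗ_)
open import Data.List.Relation.Binary.BagAndSetEquality using ([_]-Equality)
open import Data.List.Relation.Unary.All using (All)
open import Data.List.Relation.Unary.AllPairs using (AllPairs)
open import Data.Nat.Base using (ℕ; suc; _+_; _∸_; _≤_; NonZero)
open import Data.Nat.Combinatorics using (_C_)
open import Data.Product.Base using (Σ; ∃₂; ∃-syntax; _×_; _,_; proj₁)
open import Data.Product.Relation.Binary.Pointwise.NonDependent using (_×ₛ_)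
open import Data.Rational.Base as ℚ using (ℚ)
open import Data.Rational.Properties using (+-0-monoid)
open import Data.Sum.Base using (_⊎_)
open import Function.Bundles using (Inverse; _⇔_)
open import Function.Related.Propositional using (equivalence)
open import Level using (0ℓ)
open import Relation.Binary.Bundles using (Setoid)
import Relation.Binary.Construct.NonStrictToStrict as Strict
import Relation.Binary.Construct.On as On
open import Relation.Binary.PropositionalEquality using (_≢_; _≡_; setoid)
open import Relation.Nullary.Negation using (¬_)

-- The ground set {1,…,n} is represented by Fin n with its usual order.
-- The listing order of the blocks is irrelevant: partitions are compared by
-- _≈_ below.  Nonempty, pairwise disjoint blocks cannot be repeated in the
-- list, so its length is the number of blocks.
record Partition (n : ℕ) : Set where
  field
    blocks   : List (Subset n)
    nonempty : All Nonempty blocks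
    disjoint : AllPairs (λ V W → Empty (V ∩ W)) blocks
    covers   : ∀ i → ∃[ V ] (V ∈ₗ blocks × i ∈ V)

open Partition public

IsNonCrossing : ∀ {n} → Partition n → Set
IsNonCrossing {n} π =
  ¬ (∃[ V ] ∃[ W ] (V ∈ₗ blocks π × W ∈ₗ blocks π × V ≢ W ×
     ∃[ a ] ∃[ b ] ∃[ c ] ∃[ d ]
       (a Fin.< b × b Fin.< c × c Fin.< d ×
        a ∈ V × c ∈ V × b ∈ W × d ∈ W)))

record NC (n : ℕ) : Set where
  field
    partition   : Partition n
    nonCrossing : IsNonCrossing partition

open NC public

blocksNC : ∀ {n} → NC n → List (Subset n)
blocksNC π = blocks (partition π)

∣_∣ : ∀ {n} → NC n → ℕ
∣ π ∣ = length (blocksNC π)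

-- Equality of the sets of blocks.
NC-setoid : ℕ → Setoid 0ℓ 0ℓ
NC-setoid n = On.setoid ([ equivalence ]-Equality (Subset n)) (blocksNC {n})

infix 4 _≈_ _≼_ _≺_ _⋖_

_≈_ : ∀ {n} → NC n → NC n → Set
_≈_ {n} = Setoid._≈_ (NC-setoid n)

_≼_ : ∀ {n} → NC n → NC n → Set
π ≼ ρ = ∀ V → V ∈ₗ blocksNC π → ∃[ W ] (W ∈ₗ blocksNC ρ × V ⊆ W)

_≺_ : ∀ {n} → NC n → NC n → Set
_≺_ = Strict._<_ _≈_ _≼_

_⋖_ : ∀ {n} → NC n → NC n → Set
π ⋖ ρ = π ≺ ρ × ¬ (∃[ σ ] (π ≺ σ × σ ≺ ρ))

HasseEdge : ∀ {n} → NC n → NC n → Set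
HasseEdge π ρ = π ⋖ ρ ⊎ ρ ⋖ π

data Walk {n : ℕ} : ℕ → NC n → NC n → Set where
  nil  : ∀ {π ρ} → π ≈ ρ → Walk 0 π ρ
  cons : ∀ {k π σ ρ} → HasseEdge π σ → Walk k σ ρ → Walk (suc k) π ρ

-- d_H(π, ρ) = k.  A shortest walk repeats no vertex, so minimising over
-- walks and minimising over paths give the same distance.
HasHasseDistance : ∀ {n} → NC n → NC n → ℕ → Set
HasHasseDistance π ρ k = Walk k π ρ × (∀ j → Walk j π ρ → k ≤ j)

IsInterval : ∀ {n} → NC n → Set
IsInterval {n} π = ∀ V → V ∈ₗ blocksNC π →
  ∃₂ λ (p q : Fin n) → p Fin.≤ q × (∀ i → i ∈ V ⇔ (p Fin.≤ i × i Fin.≤ q))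

Subsetoid : (S : Setoid 0ℓ 0ℓ) → (Setoid.Carrier S → Set) → Setoid 0ℓ 0ℓ
Subsetoid S P = On.setoid {B = Σ (Setoid.Carrier S) P} S proj₁

HasCardinality : Setoid 0ℓ 0ℓ → ℕ → Set
HasCardinality S k = Inverse S (setoid (Fin k))

InM̅₁ : ∀ {n} → NC n × NC n → Set
InM̅₁ {n} (π , ρ) = IsInterval π × HasHasseDistance π ρ (n ∸ 1)

M̅₁ : ℕ → Setoid 0ℓ 0ℓ
M̅₁ n = Subsetoid (NC-setoid n ×ₛ NC-setoid n) InM̅₁

M̅₁-withBlocks : ℕ → ℕ → Setoid 0ℓ 0ℓ
M̅₁-withBlocks n m = Subsetoid (M̅₁ n) (λ ((π , _) , _) → ∣ π ∣ ≡ m)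

ℕ→ℚ : ℕ → ℚ
ℕ→ℚ k = + k ℚ./ 1

-- Only used for 1 ≤ m ≤ n, where the truncated subtractions are exact.
term : (n : ℕ) .{{_ : NonZero n}} → ℕ → ℚ
term n m = (+ 1 ℚ./ n) ℚ.* ℕ→ℚ (n C (m ∸ 1)) ℚ.* ℕ→ℚ ((n + m ∸ 1) C (n ∸ m))

-- The index i : Fin n stands for m = i + 1.
∑term : (n : ℕ) .{{_ : NonZero n}} → ℚ
∑term n = sum +-0-monoid (λ (i : Fin n) → term n (suc (toℕ i)))

-- For an interval partition π, the Hasse distance of π and ρ is n - 1 exactly
-- when the graph with the blocks of π and ρ as vertices and the points as edges
-- is a tree.  Walks through the coarsest and the finest partition have lengths
-- |π| + |ρ| - 2 and 2n - |π| - |ρ|, so distance n - 1 forces |π| + |ρ| = n + 1,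
-- and a proper interval I of points closed under π and ρ would give a shortcut
-- through {I, Iᶜ}.  Conversely, an upward edge of the Hasse diagram merges just
-- two blocks, so a walk joining a connected pair has at least |π| - 1 upward
-- edges, and then at least |ρ| - 1 downward ones.
--
-- Trees are read point by point from right to left.  The number of ways to reach
-- a state depends only on the total number r of blocks of ρ that are still
-- accessible: its generating function is wʳ with w = z (1 + s w (1 - w)⁻²), up to
-- a power of s.  Hence the pairs with |π| = j + 1 are counted by the coefficient
-- of zⁿ sʲ in w (1 - w)⁻¹, for which the Lagrange inversion formula can be
-- checked by a recurrence.
module Submission where

open import Defs
open import Data.Nat.Base using (ℕ; _≤_; NonZero)
open import Data.Product.Base using (∃-syntax; _×_)
open import Relation.Binary.PropositionalEquality using (_≡_)

open import Algebra.Properties.Monoid.Sum using (sum; sum-cong-≗)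
import Data.Bool.Properties as Bool
open import Data.Empty using (⊥; ⊥-elim)
open import Data.Fin.Base as Fin using (Fin; zero; suc; toℕ; fromℕ<)
import Data.Fin.Properties as Fin
open import Data.Fin.Subset using (Subset; _∈_; _∩_; Empty; Nonempty)
open import Data.Fin.Subset.Properties using (_∈?_; x∈p∩q⁺; x∈p∩q⁻; ⊆-antisym)
import Data.Integer.Base as ℤ
import Data.Integer.Properties as ℤ
open import Data.List.Base as List using (List; []; _∷_; length; drop)
open import Data.List.Membership.Propositional using () renaming (_∈_ to _∈ₗ_)
open import Data.List.Membership.Propositional.Properties using (∈-map⁺; ∈-map⁻)
open import Data.List.Membership.Propositional.Properties.WithK using (unique∧set⇒bag)
open import Data.List.Properties using (length-map; length-drop; ∷-injective; ∷-injectiveˡ; ∷-injectiveʳ)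
open import Data.List.Relation.Binary.BagAndSetEquality using (∼bag⇒↭)
open import Data.List.Relation.Binary.Permutation.Propositional.Properties using (↭-length)
open import Data.List.Relation.Unary.All as All using (All; []; _∷_)
import Data.List.Relation.Unary.All.Properties as All
open import Data.List.Relation.Unary.AllPairs as AllPairs using (AllPairs; []; _∷_)
import Data.List.Relation.Unary.AllPairs.Properties as AllPairs
open import Data.List.Relation.Unary.Any using (here; there)
open import Data.List.Relation.Unary.Unique.Propositional using (Unique)
open import Data.Maybe.Base using (Maybe; nothing; just)
open import Data.Nat.Base as ℕ using (zero; suc; pred; _+_; _*_; _∸_; z≤n; s≤s)
open import Data.Nat.Combinatorics using (_C_; nCk+nC[k+1]≡[n+1]C[k+1]; nCn≡1; k>n⇒nCk≡0; nC1≡n)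
import Data.Nat.Properties as ℕ
open import Data.Nat.Solver using (module +-*-Solver)
open import Data.Product.Base using (Σ; ∃; ∃₂; _,_; proj₁; proj₂)
open import Data.Rational.Base as ℚ using (toℚᵘ)
import Data.Rational.Properties as ℚ
open import Data.Rational.Unnormalised.Base as ℚᵘ using (mkℚᵘ; *≡*)
import Data.Rational.Unnormalised.Properties as ℚᵘ
open import Data.Sum.Base as Sum using (_⊎_; inj₁; inj₂; swap)
open import Data.Sum.Function.Propositional using (_⊎-↔_)
open import Data.Unit.Base using (⊤; tt)
open import Data.Vec.Base as Vec using (Vec; []; _∷_)
open import Data.Vec.Properties using (lookup∘tabulate; lookup⇒[]=; []=⇒lookup)
open import Function.Base using (_∘_; id)
open import Function.Bundles using (Inverse; Equivalence; _↔_; mk↔ₛ′; mk⇔)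
import Function.Construct.Composition as Composition
open import Function.Properties.Inverse using (↔-refl; ↔-sym; ↔-trans)
open import Level using (0ℓ)
open import Relation.Binary.Bundles using (Setoid)
import Relation.Binary.Construct.On as On
open import Relation.Binary.Definitions using (tri<; tri≈; tri>)
open import Relation.Binary.PropositionalEquality
  using (refl; sym; trans; cong; cong₂; subst; subst₂; setoid; module ≡-Reasoning)
import Relation.Binary.PropositionalEquality.Properties as ≡
open import Relation.Binary.Structures using (IsDecEquivalence)
open import Relation.Nullary using (¬_; Dec; yes; no; does; contradiction; _×-dec_; _⊎-dec_)
open import Relation.Nullary.Decidable using (dec-true)

open +-*-Solver using (solve; _:=_; _:+_; _:*_; con)

-- The count depends on r alone because every move can be undone freely. From a nonempty list of
-- components an isolated point can be removed in exactly one way. A joined point can be removed in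
-- one way for each pair (a, e) of natural numbers: e is the number of classes of ρ that its arc
-- hides in the component it joins, and a is 0 if the point opens a block of π, and otherwise the
-- number of visible classes of the first component, all of which the arc hides. These two free
-- numbers give the exponent in (1 - w)⁻², and the free size of the single final component gives the
-- factor (1 - w)⁻¹ in w (1 - w)⁻¹.
--
-- The obstacle is to obtain connectedness from the distance: a shortcut has to pass through
-- noncrossing partitions, so a disconnected pair must come with a noncrossing witness. Reading from
-- right to left provides it. As long as no arc of ρ shuts in a closed interval, the components are
-- runs of consecutive points; once an arc does, that interval survives to the end.

private variable n : ℕ

-- Decidable equivalence relations and the number of their classes

-- Unlike a list of blocks, a relation restricts to the points after `zero` by mere composition with
-- `suc`, which suits induction on the number of points.
record DecEquiv (n : ℕ) : Set₁ where
  field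
    rel              : Fin n → Fin n → Set
    isDecEquivalence : IsDecEquivalence rel
  open IsDecEquivalence isDecEquivalence public
    using () renaming (refl to ~refl; sym to ~sym; trans to ~trans; _≟_ to dec)

open DecEquiv

infix 4 _⊑_

_⊑_ : DecEquiv n → DecEquiv n → Set
R ⊑ S = ∀ {x y} → rel R x y → rel S x y

NonCrossing : DecEquiv n → Set
NonCrossing R = ∀ {a b c d} → a Fin.< b → b Fin.< c → c Fin.< d →
                rel R a c → rel R b d → rel R a b

Convex : DecEquiv n → Set
Convex R = ∀ {a b c} → a Fin.≤ b → b Fin.≤ c → rel R a c → rel R a b

tail : DecEquiv (suc n) → DecEquiv n
tail R = record
  { rel = λ x y → rel R (suc x) (suc y)
  ; isDecEquivalence = record
    { isEquivalence = record { refl = ~refl R ; sym = ~sym R ; trans = ~trans R }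
    ; _≟_ = λ x y → dec R (suc x) (suc y)
    }
  }

tail-nonCrossing : (R : DecEquiv (suc n)) → NonCrossing R → NonCrossing (tail R)
tail-nonCrossing R nc a<b b<c c<d = nc (s≤s a<b) (s≤s b<c) (s≤s c<d)

tail-convex : (R : DecEquiv (suc n)) → Convex R → Convex (tail R)
tail-convex R cv a≤b b≤c = cv (s≤s a≤b) (s≤s b≤c)

Linked : DecEquiv (suc n) → Set
Linked R = ∃ λ y → rel R zero (suc y)

linked? : (R : DecEquiv (suc n)) → Dec (Linked R)
linked? R = Fin.any? (λ y → dec R zero (suc y))

-- The representatives are the greatest elements of the classes.
addRep : {R : DecEquiv (suc n)} → Dec (Linked R) → List (Fin n) → List (Fin (suc n))
addRep (yes _) xs = List.map suc xs
addRep (no _)  xs = zero ∷ List.map suc xs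

reps : DecEquiv n → List (Fin n)
reps {zero}  R = []
reps {suc n} R = addRep {R = R} (linked? R) (reps (tail R))

#_ : DecEquiv n → ℕ
# R = length (reps R)

infix 8 #_

#-linked : (R : DecEquiv (suc n)) → Linked R → # R ≡ # tail R
#-linked R l with linked? R
... | yes _ = length-map suc (reps (tail R))
... | no ¬l = contradiction l ¬l

#-isolated : (R : DecEquiv (suc n)) → ¬ Linked R → # R ≡ suc (# tail R)
#-isolated R ¬l with linked? R
... | yes l = contradiction l ¬l
... | no _  = cong suc (length-map suc (reps (tail R)))

#-tail-≤ : (R : DecEquiv (suc n)) → # tail R ℕ.≤ # R
#-tail-≤ R with linked? R
... | yes _ = ℕ.≤-reflexive (sym (length-map suc (reps (tail R))))
... | no _  = ℕ.≤-trans (ℕ.n≤1+n _) (s≤s (ℕ.≤-reflexive (sym (length-map suc (reps (tail R))))))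

#-≤-suc-tail : (R : DecEquiv (suc n)) → # R ℕ.≤ suc (# tail R)
#-≤-suc-tail R with linked? R
... | yes _ = ℕ.≤-trans (ℕ.≤-reflexive (length-map suc (reps (tail R)))) (ℕ.n≤1+n _)
... | no _  = s≤s (ℕ.≤-reflexive (length-map suc (reps (tail R))))

reps-cover : (R : DecEquiv n) → ∀ x → ∃[ p ] (p ∈ₗ reps R × rel R x p)
reps-cover {suc n} R x with linked? R
reps-cover {suc n} R zero    | yes (y , r) with reps-cover (tail R) y
... | p , p∈ , rp = suc p , ∈-map⁺ suc p∈ , ~trans R r rp
reps-cover {suc n} R (suc x) | yes _ with reps-cover (tail R) x
... | p , p∈ , rp = suc p , ∈-map⁺ suc p∈ , rp
reps-cover {suc n} R zero    | no _ = zero , here refl , ~refl R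
reps-cover {suc n} R (suc x) | no _ with reps-cover (tail R) x
... | p , p∈ , rp = suc p , there (∈-map⁺ suc p∈) , rp

reps-distinct : (R : DecEquiv n) → AllPairs (λ p q → ¬ rel R p q) (reps R)
reps-distinct {zero}  R = []
reps-distinct {suc n} R with linked? R
... | yes _ = AllPairs.map⁺ (reps-distinct (tail R))
... | no ¬l = All.map⁺ (All.universal (λ y r → ¬l (y , r)) _) ∷ AllPairs.map⁺ (reps-distinct (tail R))

#-antitone : (R S : DecEquiv n) → R ⊑ S → # S ℕ.≤ # R
#-antitone {zero}  R S R⊑S = z≤n
#-antitone {suc n} R S R⊑S with linked? R
... | no ¬l = ℕ.≤-trans (#-≤-suc-tail S) (ℕ.≤-trans (s≤s (#-antitone (tail R) (tail S) R⊑S))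
                (s≤s (ℕ.≤-reflexive (sym (length-map suc (reps (tail R)))))))
... | yes (y , r) = ℕ.≤-trans (ℕ.≤-reflexive (#-linked S (y , R⊑S r)))
                (ℕ.≤-trans (#-antitone (tail R) (tail S) R⊑S)
                (ℕ.≤-reflexive (sym (length-map suc (reps (tail R))))))

-- `# R` counts the points without a related later point. A point linked in `R` is linked in `S`, so
-- equal counts force the same points to be linked; one `R`-link of `zero` then yields all its
-- `S`-links through the tails.
#-injective : (R S : DecEquiv n) → R ⊑ S → # R ℕ.≤ # S → S ⊑ R
#-injective {suc n} R S R⊑S #≤ {x} {y} = go x y
  where
  tails : # tail R ℕ.≤ # tail S
  tails with linked? R
  ... | yes (y , r) = subst (# tail R ℕ.≤_) (#-linked S (y , R⊑S r))
                        (subst (ℕ._≤ # S) (length-map suc (reps (tail R))) #≤)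
  ... | no _ = ℕ.≤-pred (ℕ.≤-trans (s≤s (ℕ.≤-reflexive (sym (length-map suc (reps (tail R))))))
                          (ℕ.≤-trans #≤ (#-≤-suc-tail S)))

  S⊑R : tail S ⊑ tail R
  S⊑R = #-injective (tail R) (tail S) R⊑S tails

  link : Linked S → Linked R
  link l with linked? R
  ... | yes l′ = l′
  ... | no ¬l  = contradiction
    (ℕ.≤-trans (ℕ.≤-trans (s≤s (ℕ.≤-reflexive (sym (length-map suc (reps (tail R)))))) #≤)
               (ℕ.≤-reflexive (#-linked S l)))
    (ℕ.<⇒≱ (s≤s (#-antitone (tail R) (tail S) R⊑S)))

  zero-suc : ∀ y → rel S zero (suc y) → rel R zero (suc y)
  zero-suc y s with link (y , s)
  ... | z , r = ~trans R r (S⊑R (~trans S (~sym S (R⊑S r)) s))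

  go : ∀ x y → rel S x y → rel R x y
  go zero    zero    s = ~refl R
  go zero    (suc y) s = zero-suc y s
  go (suc x) zero    s = ~sym R (zero-suc x (~sym S s))
  go (suc x) (suc y) s = S⊑R s

#-total : (R : DecEquiv n) → (∀ x y → rel R x y) → # R ℕ.≤ 1
#-total {zero}        R all = z≤n
#-total {suc zero}    R all = #-≤-suc-tail R
#-total {suc (suc n)} R all = subst (ℕ._≤ 1) (sym (#-linked R (zero , all _ _)))
  (#-total (tail R) (λ x y → all (suc x) (suc y)))

#-positive : (R : DecEquiv (suc n)) → 1 ℕ.≤ # R
#-positive {zero}  R = ℕ.≤-reflexive (sym (#-isolated R λ ()))
#-positive {suc n} R = ℕ.≤-trans (#-positive (tail R)) (#-tail-≤ R)

#-≤ : (R : DecEquiv n) → # R ℕ.≤ n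
#-≤ {zero}  R = z≤n
#-≤ {suc n} R = ℕ.≤-trans (#-≤-suc-tail R) (s≤s (#-≤ (tail R)))

InEither : DecEquiv n → (x y a : Fin n) → Set
InEither R x y a = rel R a x ⊎ rel R a y

merge : DecEquiv n → (x y : Fin n) → DecEquiv n
merge R x y = record
  { rel = λ a b → rel R a b ⊎ (InEither R x y a × InEither R x y b)
  ; isDecEquivalence = record
    { isEquivalence = record
      { refl  = inj₁ (~refl R)
      ; sym   = Sum.map (~sym R) (λ (p , q) → q , p)
      ; trans = trans′
      }
    ; _≟_ = λ a b → dec R a b ⊎-dec (in? a ×-dec in? b)
    }
  }
  where
  in? : ∀ a → Dec (InEither R x y a)
  in? a = dec R a x ⊎-dec dec R a y

  move : ∀ {a b} → rel R a b → InEither R x y b → InEither R x y a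
  move r = Sum.map (~trans R r) (~trans R r)

  trans′ : ∀ {a b c} → rel R a b ⊎ (InEither R x y a × InEither R x y b) →
           rel R b c ⊎ (InEither R x y b × InEither R x y c) →
           rel R a c ⊎ (InEither R x y a × InEither R x y c)
  trans′ (inj₁ r)       (inj₁ s)       = inj₁ (~trans R r s)
  trans′ (inj₁ r)       (inj₂ (p , q)) = inj₂ (move r p , q)
  trans′ (inj₂ (p , q)) (inj₁ s)       = inj₂ (p , move (~sym R s) q)
  trans′ (inj₂ (p , _)) (inj₂ (_ , q)) = inj₂ (p , q)

merge-increasing : (R : DecEquiv n) (x y : Fin n) → R ⊑ merge R x y
merge-increasing R x y = inj₁

merge-joins : (R : DecEquiv n) (x y : Fin n) → rel (merge R x y) x y
merge-joins R x y = inj₂ (inj₁ (~refl R) , inj₂ (~refl R))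

merge-least : (R S : DecEquiv n) {x y : Fin n} → R ⊑ S → rel S x y → merge R x y ⊑ S
merge-least R S {x} {y} R⊑S s (inj₁ r)       = R⊑S r
merge-least R S {x} {y} R⊑S s (inj₂ (p , q)) = ~trans S (toX p) (~sym S (toX q))
  where
  toX : ∀ {a} → InEither R x y a → rel S a x
  toX (inj₁ r) = R⊑S r
  toX (inj₂ r) = ~trans S (R⊑S r) (~sym S s)

merge-sym : (R : DecEquiv n) (x y : Fin n) → merge R x y ⊑ merge R y x
merge-sym R x y = Sum.map id (λ (p , q) → swap p , swap q)

#-merge : (R : DecEquiv n) (x y : Fin n) → # R ℕ.≤ suc (# merge R x y)
-- If `zero` is linked to some `z`, the merge restricts to the tail as a merge of `z` and `y`. If it
-- is isolated, the tail does not change, and only `zero` ceases to be a representative.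
#-merge-zero : (R : DecEquiv (suc n)) (y : Fin n) → # R ℕ.≤ suc (# merge R zero (suc y))

#-merge R zero zero = ℕ.≤-trans (#-antitone (merge R zero zero) R (merge-least R R id (~refl R))) (ℕ.n≤1+n _)
#-merge R zero (suc y) = #-merge-zero R y
#-merge R (suc x) zero = ℕ.≤-trans (#-merge-zero R x)
  (s≤s (#-antitone (merge R (suc x) zero) (merge R zero (suc x)) (merge-sym R (suc x) zero)))
#-merge R (suc x) (suc y) with linked? R
... | yes l = subst (ℕ._≤ suc (# M)) (sym (length-map suc (reps (tail R))))
    (ℕ.≤-trans tails (s≤s (#-tail-≤ M)))
  where
  M = merge R (suc x) (suc y)
  tails : # tail R ℕ.≤ suc (# tail M)
  tails = ℕ.≤-trans (#-merge (tail R) x y) (s≤s (#-antitone (tail M) (merge (tail R) x y) id))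
... | no ¬l = subst₂ ℕ._≤_ (cong suc (sym (length-map suc (reps (tail R))))) (cong suc (sym (#-isolated M ¬l′)))
    (s≤s tails)
  where
  M = merge R (suc x) (suc y)
  tails : # tail R ℕ.≤ suc (# tail M)
  tails = ℕ.≤-trans (#-merge (tail R) x y) (s≤s (#-antitone (tail M) (merge (tail R) x y) id))
  ¬l′ : ¬ Linked M
  ¬l′ (z , inj₁ r)            = ¬l (z , r)
  ¬l′ (z , inj₂ (inj₁ r , _)) = ¬l (x , r)
  ¬l′ (z , inj₂ (inj₂ r , _)) = ¬l (y , r)

#-merge-zero R y with linked? R
... | yes (z , r) = subst (ℕ._≤ suc (# M)) (sym (length-map suc (reps (tail R))))
    (ℕ.≤-trans (#-merge (tail R) z y)
      (s≤s (ℕ.≤-trans (#-antitone (tail M) (merge (tail R) z y) shrink) (#-tail-≤ M))))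
  where
  M = merge R zero (suc y)
  shift : ∀ {a} → InEither R zero (suc y) (suc a) → InEither (tail R) z y a
  shift = Sum.map (λ s → ~trans R s r) id
  shrink : tail M ⊑ merge (tail R) z y
  shrink = Sum.map id (λ (p , q) → shift p , shift q)
... | no ¬l = s≤s (subst (ℕ._≤ # M) (sym (length-map suc (reps (tail R))))
    (ℕ.≤-trans (#-antitone (tail M) (tail R) shrink) (#-tail-≤ M)))
  where
  M = merge R zero (suc y)
  target : ∀ {a} → InEither R zero (suc y) (suc a) → rel R (suc a) (suc y)
  target (inj₁ r) = contradiction (_ , ~sym R r) ¬l
  target (inj₂ r) = r
  shrink : tail M ⊑ tail R
  shrink (inj₁ r)       = r
  shrink (inj₂ (p , q)) = ~trans R (target p) (~sym R (target q))

-- Consecutive points of a class and noncrossing merges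

least : {P : Fin n → Set} → (∀ x → Dec (P x)) → ∃ P → ∃[ x ] (P x × (∀ y → y Fin.< x → ¬ P y))
least {suc n} P? (x , px) with P? zero
... | yes p0 = zero , p0 , λ y ()
least {suc n} P? (zero , px)  | no ¬p0 = contradiction px ¬p0
least {suc n} P? (suc x , px) | no ¬p0 with least (P? ∘ suc) (x , px)
... | z , pz , min = suc z , pz , λ { zero _ → ¬p0 ; (suc y) (s≤s y<z) → min y y<z }

greatest : {P : Fin n → Set} → (∀ x → Dec (P x)) → ∃ P → ∃[ x ] (P x × (∀ y → P y → y Fin.≤ x))
greatest {suc n} P? (x , px) with Fin.any? (P? ∘ suc)
... | yes e with greatest (P? ∘ suc) e
...   | z , pz , max = suc z , pz , λ { zero _ → z≤n ; (suc y) py → s≤s (max y py) }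
greatest {suc n} P? (zero , px)  | no ¬e = zero , px , λ { zero _ → z≤n ; (suc y) py → contradiction (y , py) ¬e }
greatest {suc n} P? (suc x , px) | no ¬e = contradiction (x , px) ¬e

record Consecutive (S : DecEquiv n) (x y : Fin n) : Set where
  field
    x<y     : x Fin.< y
    related : rel S x y
    between : ∀ z → x Fin.< z → z Fin.< y → ¬ rel S x z

  outside : ∀ {z} → rel S x z → z Fin.≤ x ⊎ y Fin.≤ z
  outside {z} r with Fin.<-cmp z x | Fin.<-cmp z y
  ... | tri< z<x _ _ | _ = inj₁ (ℕ.<⇒≤ z<x)
  ... | tri≈ _ refl _ | _ = inj₁ ℕ.≤-refl
  ... | _ | tri≈ _ refl _ = inj₂ ℕ.≤-refl
  ... | _ | tri> _ _ y<z = inj₂ (ℕ.<⇒≤ y<z)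
  ... | tri> _ _ x<z | tri< z<y _ _ = contradiction r (between z x<z z<y)

-- Consecutive pairs generate `S`, so a strictly finer `R` must separate one of them. The pair
-- starting at `zero` ends in the least point related to it.
splitting-pair : (R S : DecEquiv n) → R ⊑ S → S ⊑ R ⊎ (∃₂ λ x y → Consecutive S x y × ¬ rel R x y)
splitting-pair {zero}  R S R⊑S = inj₁ λ { {()} }
splitting-pair {suc n} R S R⊑S with splitting-pair (tail R) (tail S) R⊑S
... | inj₂ (x , y , c , ¬r) = inj₂ (suc x , suc y , record
      { x<y = s≤s x<y ; related = related
      ; between = λ { (suc z) (s≤s x<z) (s≤s z<y) → between z x<z z<y } } , ¬r)
  where open Consecutive c
... | inj₁ S⊑R with linked? S
...   | no ¬l = inj₁ (λ {x} {y} → go x y)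
  where
  go : ∀ x y → rel S x y → rel R x y
  go zero    zero    s = ~refl R
  go zero    (suc y) s = contradiction (y , s) ¬l
  go (suc x) zero    s = contradiction (x , ~sym S s) ¬l
  go (suc x) (suc y) s = S⊑R s
...   | yes l with least (λ y → dec S zero (suc y)) l
...     | y , s₀ , min with dec R zero (suc y)
...       | no ¬r = inj₂ (zero , suc y , record
      { x<y = s≤s z≤n ; related = s₀
      ; between = λ { (suc z) _ (s≤s z<y) → min z z<y } } , ¬r)
...       | yes r = inj₁ (λ {x} {y} → go x y)
  where
  go₀ : ∀ z → rel S zero (suc z) → rel R zero (suc z)
  go₀ z s = ~trans R r (S⊑R (~trans S (~sym S s₀) s))
  go : ∀ x y → rel S x y → rel R x y
  go zero    zero    s = ~refl R
  go zero    (suc z) s = go₀ z s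
  go (suc z) zero    s = ~sym R (go₀ z (~sym S s))
  go (suc x) (suc y) s = S⊑R s

nested : (R : DecEquiv n) → NonCrossing R → ∀ {u v p q} → rel R u v → ¬ rel R u p → rel R p q →
         u Fin.< p → p Fin.< v → u Fin.< q × q Fin.< v
nested R nc {u} {v} {p} {q} uv ¬up pq u<p p<v with Fin.<-cmp u q | Fin.<-cmp q v
... | tri< u<q _ _ | tri< q<v _ _ = u<q , q<v
... | tri≈ _ refl _ | _ = contradiction (~sym R pq) ¬up
... | tri> _ _ q<u | _ = contradiction (~trans R (~sym R (nc q<u u<p p<v (~sym R pq) uv)) (~sym R pq)) ¬up
... | _ | tri≈ _ refl _ = contradiction (~trans R uv (~sym R pq)) ¬up
... | tri< _ _ _ | tri> _ _ v<q = contradiction (nc u<p p<v v<q uv pq) ¬up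

-- The consecutive points x and y of an S-class lie on the same side of every
-- arc of a finer relation, hence so do their two classes.
merge-nonCrossing : (R S : DecEquiv n) → R ⊑ S → NonCrossing R → NonCrossing S →
                    ∀ {x y} → Consecutive S x y → NonCrossing (merge R x y)
merge-nonCrossing R S R⊑S ncR ncS {x} {y} cs = main
  where
  open Consecutive cs
  M = merge R x y
  M⊑S : M ⊑ S
  M⊑S = merge-least R S R⊑S related

  toX : ∀ {a} → InEither R x y a → rel S a x
  toX (inj₁ r) = R⊑S r
  toX (inj₂ r) = ~trans S (R⊑S r) (~sym S related)

  in? : ∀ a → Dec (InEither R x y a)
  in? a = dec R a x ⊎-dec dec R a y

  move : ∀ {a b} → rel R a b → InEither R x y b → InEither R x y a
  move r = Sum.map (~trans R r) (~trans R r)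

  same-side : ∀ {u v p q} → rel R u v → ¬ InEither R x y u → rel S u x →
              InEither R x y p → InEither R x y q →
              u Fin.< p → p Fin.< v → u Fin.< q × q Fin.< v
  same-side {u} {v} uv ¬u ux p∈ q∈ u<p p<v = from (mid p∈ u<p p<v) q∈
    where
    ¬ux : ¬ rel R u x
    ¬ux = ¬u ∘ inj₁
    ¬uy : ¬ rel R u y
    ¬uy = ¬u ∘ inj₂
    mid : ∀ {p} → InEither R x y p → u Fin.< p → p Fin.< v → (u Fin.< x × x Fin.< v) × (u Fin.< y × y Fin.< v)
    mid (inj₁ px) u<p p<v with nested R ncR uv (λ up → ¬ux (~trans R up px)) px u<p p<v
    ... | u<x , x<v with outside (~trans S (~sym S ux) (R⊑S uv))
    ...   | inj₁ v≤x = contradiction x<v (ℕ.≤⇒≯ v≤x)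
    ...   | inj₂ y≤v = (u<x , x<v) , (ℕ.<-trans u<x x<y , Fin.≤∧≢⇒< y≤v λ { refl → ¬uy uv })
    mid (inj₂ py) u<p p<v with nested R ncR uv (λ up → ¬uy (~trans R up py)) py u<p p<v
    ... | u<y , y<v with outside (~sym S ux)
    ...   | inj₂ y≤u = contradiction u<y (ℕ.≤⇒≯ y≤u)
    ...   | inj₁ u≤x = (Fin.≤∧≢⇒< u≤x (λ { refl → ¬ux (~refl R) }) , ℕ.<-trans x<y y<v) , (u<y , y<v)
    from : (u Fin.< x × x Fin.< v) × (u Fin.< y × y Fin.< v) → ∀ {q} → InEither R x y q → u Fin.< q × q Fin.< v
    from ((u<x , x<v) , _) (inj₁ qx) = nested R ncR uv ¬ux (~sym R qx) u<x x<v
    from (_ , (u<y , y<v)) (inj₂ qy) = nested R ncR uv ¬uy (~sym R qy) u<y y<v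

  main : NonCrossing M
  main {a} {b} {c} {d} a<b b<c c<d ac bd with in? a | in? b
  ... | yes a∈ | yes b∈ = inj₂ (a∈ , b∈)
  main a<b b<c c<d (inj₁ ac) (inj₁ bd) | _ | _ = inj₁ (ncR a<b b<c c<d ac bd)
  main a<b b<c c<d (inj₂ (a∈ , c∈)) _ | no a∉ | _ = contradiction a∈ a∉
  main a<b b<c c<d _ (inj₂ (b∈ , d∈)) | _ | no b∉ = contradiction b∈ b∉
  -- As `S` is noncrossing, `a` belongs to the `S`-class of `x` and `y`. Both merged classes then
  -- lie on one side of the arc from `a` to `c`, so `d` comes before `c` because `b` does.
  main a<b b<c c<d (inj₁ ac) (inj₂ (b∈ , d∈)) | no a∉ | yes _ =
    contradiction (proj₂ (same-side ac a∉ ax b∈ d∈ a<b b<c)) (ℕ.<⇒≯ c<d)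
    where ax = ~trans S (ncS a<b b<c c<d (R⊑S ac) (M⊑S (inj₂ (b∈ , d∈)))) (toX b∈)
  main a<b b<c c<d (inj₂ (a∈ , c∈)) (inj₁ bd) | yes _ | no b∉ =
    contradiction (proj₁ (same-side bd b∉ bx c∈ a∈ b<c c<d)) (ℕ.<⇒≯ a<b)
    where bx = ~trans S (~sym S (ncS a<b b<c c<d (M⊑S (inj₂ (a∈ , c∈))) (R⊑S bd))) (toX a∈)

-- Partitions as equivalence relations

class : DecEquiv n → Fin n → Subset n
class R x = Vec.tabulate (λ y → does (dec R x y))

∈-class⁺ : (R : DecEquiv n) {x y : Fin n} → rel R x y → y ∈ class R x
∈-class⁺ R {x} {y} r = lookup⇒[]= y _ (trans (lookup∘tabulate _ y) (dec-true (dec R x y) r))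

∈-class⁻ : (R : DecEquiv n) {x y : Fin n} → y ∈ class R x → rel R x y
∈-class⁻ R {x} {y} y∈ with dec R x y | trans (sym (lookup∘tabulate (λ y → does (dec R x y)) y)) ([]=⇒lookup y∈)
... | yes r | _ = r
... | no _  | ()

disjoint-unique : {Vs : List (Subset n)} → AllPairs (λ V W → Empty (V ∩ W)) Vs →
                  ∀ {V W x} → V ∈ₗ Vs → W ∈ₗ Vs → x ∈ V → x ∈ W → V ≡ W
disjoint-unique (d ∷ ds) (here refl) (here refl) x∈V x∈W = refl
disjoint-unique (d ∷ ds) (here refl) (there W∈)  x∈V x∈W = contradiction (_ , x∈p∩q⁺ (x∈V , x∈W)) (All.lookup d W∈)
disjoint-unique (d ∷ ds) (there V∈)  (here refl) x∈V x∈W = contradiction (_ , x∈p∩q⁺ (x∈W , x∈V)) (All.lookup d V∈)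
disjoint-unique (d ∷ ds) (there V∈)  (there W∈)  x∈V x∈W = disjoint-unique ds V∈ W∈ x∈V x∈W

disjoint⇒Unique : {Vs : List (Subset n)} → All Nonempty Vs → AllPairs (λ V W → Empty (V ∩ W)) Vs → Unique Vs
disjoint⇒Unique [] [] = []
disjoint⇒Unique ((x , x∈V) ∷ ne) (d ∷ ds) =
  All.map (λ { e refl → e (x , x∈p∩q⁺ (x∈V , x∈V)) }) d ∷ disjoint⇒Unique ne ds

module _ (π : NC n) where

  blockOf : Fin n → Subset n
  blockOf x = proj₁ (covers (partition π) x)

  blockOf∈ : ∀ x → blockOf x ∈ₗ blocksNC π
  blockOf∈ x = proj₁ (proj₂ (covers (partition π) x))

  ∈blockOf : ∀ x → x ∈ blockOf x
  ∈blockOf x = proj₂ (proj₂ (covers (partition π) x))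

  block-unique : ∀ {V W x} → V ∈ₗ blocksNC π → W ∈ₗ blocksNC π → x ∈ V → x ∈ W → V ≡ W
  block-unique = disjoint-unique (disjoint (partition π))

  blockOf-unique : ∀ {V x} → V ∈ₗ blocksNC π → x ∈ V → blockOf x ≡ V
  blockOf-unique V∈ x∈V = block-unique (blockOf∈ _) V∈ (∈blockOf _) x∈V

  block-element : ∀ {V} → V ∈ₗ blocksNC π → ∃[ x ] x ∈ V
  block-element = All.lookup (nonempty (partition π))

  equiv : DecEquiv n
  equiv = record
    { rel = λ x y → y ∈ blockOf x
    ; isDecEquivalence = record
      { isEquivalence = record
        { refl  = ∈blockOf _
        ; sym   = λ {x} {y} y∈ → subst (x ∈_) (sym (blockOf-unique (blockOf∈ x) y∈)) (∈blockOf x)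
        ; trans = λ {x} {y} {z} y∈ z∈ → subst (z ∈_) (blockOf-unique (blockOf∈ x) y∈) z∈
        }
      ; _≟_ = λ x y → y ∈? blockOf x
      }
    }

  equiv-intro : ∀ {V x y} → V ∈ₗ blocksNC π → x ∈ V → y ∈ V → rel equiv x y
  equiv-intro V∈ x∈V y∈V = subst (_ ∈_) (sym (blockOf-unique V∈ x∈V)) y∈V

  equiv-elim : ∀ {V x y} → V ∈ₗ blocksNC π → x ∈ V → rel equiv x y → y ∈ V
  equiv-elim V∈ x∈V r = subst (_ ∈_) (blockOf-unique V∈ x∈V) r

  equiv-nonCrossing : NonCrossing equiv
  equiv-nonCrossing {a} {b} {c} {d} a<b b<c c<d ac bd with dec equiv a b
  ... | yes r = r
  ... | no ¬r = contradiction
    (blockOf a , blockOf b , blockOf∈ a , blockOf∈ b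
    , (λ eq → ¬r (subst (b ∈_) (sym eq) (∈blockOf b)))
    , a , b , c , d , a<b , b<c , c<d , ∈blockOf a , ac , ∈blockOf b , bd)
    (nonCrossing π)

  equiv-convex : IsInterval π → Convex equiv
  equiv-convex int {a} {b} {c} a≤b b≤c ac with int (blockOf a) (blockOf∈ a)
  ... | p , q , _ , iff = Equivalence.from (iff b)
    (ℕ.≤-trans (proj₁ (Equivalence.to (iff a) (∈blockOf a))) a≤b
    , ℕ.≤-trans b≤c (proj₂ (Equivalence.to (iff c) ac)))

  convex⇒interval : Convex equiv → IsInterval π
  convex⇒interval cv V V∈ with least (_∈? V) (block-element V∈) | greatest (_∈? V) (block-element V∈)
  ... | p , p∈ , min | q , q∈ , max = p , q , max p p∈ , λ i → mk⇔
    (λ i∈ → ℕ.≮⇒≥ (λ i<p → min i i<p i∈) , max i i∈)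
    (λ (p≤i , i≤q) → equiv-elim V∈ p∈ (cv p≤i i≤q (equiv-intro V∈ p∈ q∈)))

≼⇒⊑ : (π ρ : NC n) → π ≼ ρ → equiv π ⊑ equiv ρ
≼⇒⊑ π ρ π≼ρ {x} xy with π≼ρ (blockOf π x) (blockOf∈ π x)
... | W , W∈ , V⊆W = equiv-intro ρ W∈ (V⊆W (∈blockOf π x)) (V⊆W xy)

⊑⇒≼ : (π ρ : NC n) → equiv π ⊑ equiv ρ → π ≼ ρ
⊑⇒≼ π ρ π⊑ρ V V∈ with block-element π V∈
... | x , x∈V = blockOf ρ x , blockOf∈ ρ x , λ y∈V → π⊑ρ (equiv-intro π V∈ x∈V y∈V)

≈⇒⊑ : (π ρ : NC n) → π ≈ ρ → equiv π ⊑ equiv ρ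
≈⇒⊑ π ρ π≈ρ {x} xy = equiv-intro ρ (Equivalence.to π≈ρ (blockOf∈ π x)) (∈blockOf π x) xy

≈-sym : (π ρ : NC n) → π ≈ ρ → ρ ≈ π
≈-sym π ρ π≈ρ = mk⇔ (Equivalence.from π≈ρ) (Equivalence.to π≈ρ)

≈⇒⊒ : (π ρ : NC n) → π ≈ ρ → equiv ρ ⊑ equiv π
≈⇒⊒ π ρ π≈ρ = ≈⇒⊑ ρ π (≈-sym π ρ π≈ρ)

⊑-antisym : (π ρ : NC n) → equiv π ⊑ equiv ρ → equiv ρ ⊑ equiv π → π ≈ ρ
⊑-antisym π ρ π⊑ρ ρ⊑π = mk⇔ (half π ρ π⊑ρ ρ⊑π) (half ρ π ρ⊑π π⊑ρ)
  where
  half : (π ρ : NC _) → equiv π ⊑ equiv ρ → equiv ρ ⊑ equiv π → ∀ {V} → V ∈ₗ blocksNC π → V ∈ₗ blocksNC ρ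
  half π ρ π⊑ρ ρ⊑π V∈ with block-element π V∈
  ... | x , x∈V = subst (_∈ₗ blocksNC ρ)
    (⊆-antisym (λ y∈ → equiv-elim π V∈ x∈V (ρ⊑π y∈)) (λ y∈V → π⊑ρ (equiv-intro π V∈ x∈V y∈V)))
    (blockOf∈ ρ x)

module _ (R : DecEquiv n) where

  classes : List (Subset n)
  classes = List.map (class R) (reps R)

  classes-cover : ∀ x → ∃[ V ] (V ∈ₗ classes × x ∈ V)
  classes-cover x with reps-cover R x
  ... | p , p∈ , r = class R p , ∈-map⁺ (class R) p∈ , ∈-class⁺ R (~sym R r)

  quotient : Partition n
  quotient = record
    { blocks   = classes
    ; nonempty = All.map⁺ (All.universal (λ p → p , ∈-class⁺ R (~refl R)) _)
    ; disjoint = AllPairs.map⁺ (AllPairs.map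
        (λ {p} {q} ¬r → λ (x , x∈) → let (x∈p , x∈q) = x∈p∩q⁻ (class R p) (class R q) x∈ in
           ¬r (~trans R (∈-class⁻ R x∈p) (~sym R (∈-class⁻ R x∈q))))
        (reps-distinct R))
    ; covers   = classes-cover
    }

  quotient-nonCrossing : NonCrossing R → IsNonCrossing quotient
  quotient-nonCrossing nc (V , W , V∈ , W∈ , V≢W , a , b , c , d , a<b , b<c , c<d , a∈ , c∈ , b∈ , d∈)
    with ∈-map⁻ (class R) V∈ | ∈-map⁻ (class R) W∈
  ... | p , _ , refl | q , _ , refl = V≢W (disjoint-unique (disjoint quotient) V∈ W∈ a∈
        (∈-class⁺ R (~trans R (∈-class⁻ R b∈) (~sym R
          (nc a<b b<c c<d (~trans R (~sym R (∈-class⁻ R a∈)) (∈-class⁻ R c∈))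
                          (~trans R (~sym R (∈-class⁻ R b∈)) (∈-class⁻ R d∈)))))))

fromEquiv : (R : DecEquiv n) → NonCrossing R → NC n
fromEquiv R nc = record { partition = quotient R ; nonCrossing = quotient-nonCrossing R nc }

module _ (R : DecEquiv n) (nc : NonCrossing R) where

  fromEquiv-⊑ : equiv (fromEquiv R nc) ⊑ R
  fromEquiv-⊑ {x} {y} r with ∈-map⁻ (class R) (blockOf∈ (fromEquiv R nc) x)
  ... | p , _ , eq = ~trans R (~sym R (∈-class⁻ R (subst (x ∈_) eq (∈blockOf (fromEquiv R nc) x))))
                              (∈-class⁻ R (subst (y ∈_) eq r))

  fromEquiv-⊒ : R ⊑ equiv (fromEquiv R nc)
  fromEquiv-⊒ {x} {y} r = equiv-intro (fromEquiv R nc) (∈-map⁺ (class R) p∈) (∈-class⁺ R (~sym R xp))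
                            (∈-class⁺ R (~trans R (~sym R xp) r))
    where
    p∈ = proj₁ (proj₂ (reps-cover R x))
    xp = proj₂ (proj₂ (reps-cover R x))

≈⇒∣∣≡ : (π ρ : NC n) → π ≈ ρ → ∣ π ∣ ≡ ∣ ρ ∣
≈⇒∣∣≡ π ρ π≈ρ = ↭-length (∼bag⇒↭ (unique∧set⇒bag (unique π) (unique ρ) π≈ρ))
  where
  unique : (π : NC _) → Unique (blocksNC π)
  unique π = disjoint⇒Unique (nonempty (partition π)) (disjoint (partition π))

∣∣≡# : (π : NC n) → ∣ π ∣ ≡ # equiv π
∣∣≡# π = trans
  (≈⇒∣∣≡ π ρ (⊑-antisym π ρ (fromEquiv-⊒ (equiv π) (equiv-nonCrossing π)) (fromEquiv-⊑ (equiv π) (equiv-nonCrossing π))))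
  (length-map (class (equiv π)) (reps (equiv π)))
  where ρ = fromEquiv (equiv π) (equiv-nonCrossing π)

-- Covers and walks in the Hasse diagram

private variable j k : ℕ

≺⇒⋢ : (π ρ : NC n) → π ≺ ρ → ¬ (equiv ρ ⊑ equiv π)
≺⇒⋢ π ρ (π≼ρ , π≉ρ) ρ⊑π = π≉ρ (⊑-antisym π ρ (≼⇒⊑ π ρ π≼ρ) ρ⊑π)

⊑∧⋢⇒≺ : (π ρ : NC n) → equiv π ⊑ equiv ρ → ¬ (equiv ρ ⊑ equiv π) → π ≺ ρ
⊑∧⋢⇒≺ π ρ π⊑ρ ρ⋢π = ⊑⇒≼ π ρ π⊑ρ , λ π≈ρ → ρ⋢π (≈⇒⊒ π ρ π≈ρ)

≺⇒⊑ : (π ρ : NC n) → π ≺ ρ → equiv π ⊑ equiv ρ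
≺⇒⊑ π ρ π≺ρ = ≼⇒⊑ π ρ (proj₁ π≺ρ)

≺⇒#> : (π ρ : NC n) → π ≺ ρ → # equiv ρ ℕ.< # equiv π
≺⇒#> π ρ π≺ρ = ℕ.≰⇒> (≺⇒⋢ π ρ π≺ρ ∘ #-injective (equiv π) (equiv ρ) (≺⇒⊑ π ρ π≺ρ))

#-merge-≡ : (R : DecEquiv n) {x y : Fin n} → ¬ rel R x y → # R ≡ suc (# merge R x y)
#-merge-≡ R {x} {y} ¬r = ℕ.≤-antisym (#-merge R x y)
  (ℕ.≰⇒> λ le → ¬r (#-injective R (merge R x y) (merge-increasing R x y) le (merge-joins R x y)))

module _ (π τ : NC n) (π⊑τ : equiv π ⊑ equiv τ) {x y : Fin n}
         (cs : Consecutive (equiv τ) x y) (¬xy : ¬ rel (equiv π) x y) where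

  private
    M = merge (equiv π) x y
    ncM = merge-nonCrossing (equiv π) (equiv τ) π⊑τ (equiv-nonCrossing π) (equiv-nonCrossing τ) cs

  mergeNC : NC n
  mergeNC = fromEquiv M ncM

  mergeNC⊑merge : equiv mergeNC ⊑ M
  mergeNC⊑merge = fromEquiv-⊑ M ncM

  merge⊑mergeNC : M ⊑ equiv mergeNC
  merge⊑mergeNC = fromEquiv-⊒ M ncM

  mergeNC⊑ : equiv mergeNC ⊑ equiv τ
  mergeNC⊑ = merge-least (equiv π) (equiv τ) π⊑τ (Consecutive.related cs) ∘ mergeNC⊑merge

  ≺mergeNC : π ≺ mergeNC
  ≺mergeNC = ⊑∧⋢⇒≺ π mergeNC (merge⊑mergeNC ∘ merge-increasing (equiv π) x y)
    (λ M⊑π → ¬xy (M⊑π (merge⊑mergeNC (merge-joins (equiv π) x y))))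

  #-mergeNC : # equiv π ≡ suc (# equiv mergeNC)
  #-mergeNC = trans (#-merge-≡ (equiv π) ¬xy) (cong suc (ℕ.≤-antisym
    (#-antitone (equiv mergeNC) M mergeNC⊑merge) (#-antitone M (equiv mergeNC) merge⊑mergeNC)))

  -- The numbers of blocks differ by one, and a partition strictly in between would need a number
  -- strictly in between.
  ⋖mergeNC : π ⋖ mergeNC
  ⋖mergeNC = ≺mergeNC , λ (υ , π≺υ , υ≺M) →
    ℕ.<⇒≱ (≺⇒#> υ mergeNC υ≺M)
      (ℕ.≤-pred (ℕ.≤-trans (≺⇒#> π υ π≺υ) (ℕ.≤-reflexive #-mergeNC)))

-- Merging two consecutive classes within a τ-class gives a noncrossing
-- partition between π and τ, which must be τ when τ covers π.
⋖⇒merge : (π τ : NC n) → π ⋖ τ →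
          (∃₂ λ x y → equiv τ ⊑ merge (equiv π) x y) × # equiv π ≡ suc (# equiv τ)
⋖⇒merge π τ (π≺τ , cover) with splitting-pair (equiv π) (equiv τ) (≺⇒⊑ π τ π≺τ)
... | inj₁ τ⊑π = ⊥-elim (≺⇒⋢ π τ π≺τ τ⊑π)
... | inj₂ (x , y , cs , ¬xy) = (x , y , λ t → mergeNC⊑merge π τ π⊑τ cs ¬xy (τ⊑μ t))
    , trans (#-mergeNC π τ π⊑τ cs ¬xy) (cong suc (ℕ.≤-antisym
        (#-antitone (equiv τ) (equiv μ) τ⊑μ) (#-antitone (equiv μ) (equiv τ) μ⊑τ)))
  where
  π⊑τ : equiv π ⊑ equiv τ
  π⊑τ = ≺⇒⊑ π τ π≺τ
  μ : NC _
  μ = mergeNC π τ π⊑τ cs ¬xy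
  μ⊑τ : equiv μ ⊑ equiv τ
  μ⊑τ = mergeNC⊑ π τ π⊑τ cs ¬xy
  τ⊑μ : equiv τ ⊑ equiv μ
  τ⊑μ with splitting-pair (equiv μ) (equiv τ) μ⊑τ
  ... | inj₁ τ⊑μ = τ⊑μ
  ... | inj₂ (u , v , c , ¬uv) = contradiction
          (μ , ≺mergeNC π τ π⊑τ cs ¬xy , ⊑∧⋢⇒≺ μ τ μ⊑τ (λ τ⊑μ → ¬uv (τ⊑μ (Consecutive.related c))))
          cover

≺-respˡ : (π σ ρ : NC n) → π ≈ σ → σ ≺ ρ → π ≺ ρ
≺-respˡ π σ ρ π≈σ σ≺ρ = ⊑∧⋢⇒≺ π ρ (λ r → ≺⇒⊑ σ ρ σ≺ρ (≈⇒⊑ π σ π≈σ r))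
  (λ ρ⊑π → ≺⇒⋢ σ ρ σ≺ρ (λ r → ≈⇒⊑ π σ π≈σ (ρ⊑π r)))

≺-respʳ : (π σ ρ : NC n) → π ≈ σ → ρ ≺ σ → ρ ≺ π
≺-respʳ π σ ρ π≈σ ρ≺σ = ⊑∧⋢⇒≺ ρ π (λ r → ≈⇒⊒ π σ π≈σ (≺⇒⊑ ρ σ ρ≺σ r))
  (λ π⊑ρ → ≺⇒⋢ ρ σ ρ≺σ (λ r → π⊑ρ (≈⇒⊒ π σ π≈σ r)))

-- Walks end in `≈` and not in an identity, so concatenating them needs edges to be invariant under
-- `≈`.
edge-respˡ : (π σ ρ : NC n) → π ≈ σ → HasseEdge σ ρ → HasseEdge π ρ
edge-respˡ π σ ρ π≈σ (inj₁ (σ≺ρ , cover)) = inj₁ (≺-respˡ π σ ρ π≈σ σ≺ρ ,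
  λ (υ , π≺υ , υ≺ρ) → cover (υ , ≺-respˡ σ π υ (≈-sym π σ π≈σ) π≺υ , υ≺ρ))
edge-respˡ π σ ρ π≈σ (inj₂ (ρ≺σ , cover)) = inj₂ (≺-respʳ π σ ρ π≈σ ρ≺σ ,
  λ (υ , ρ≺υ , υ≺π) → cover (υ , ρ≺υ , ≺-respʳ σ π υ (≈-sym π σ π≈σ) υ≺π))

≈-trans : (π σ ρ : NC n) → π ≈ σ → σ ≈ ρ → π ≈ ρ
≈-trans π σ ρ π≈σ σ≈ρ = ⊑-antisym π ρ (λ r → ≈⇒⊑ σ ρ σ≈ρ (≈⇒⊑ π σ π≈σ r)) (λ r → ≈⇒⊒ π σ π≈σ (≈⇒⊒ σ ρ σ≈ρ r))

≈-refl : (π : NC n) → π ≈ π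
≈-refl π = mk⇔ id id

walk-respˡ : (π σ ρ : NC n) → π ≈ σ → Walk k σ ρ → Walk k π ρ
walk-respˡ π σ ρ π≈σ (nil σ≈ρ)           = nil (≈-trans π σ ρ π≈σ σ≈ρ)
walk-respˡ π σ ρ π≈σ (cons {σ = υ} e w) = cons (edge-respˡ π σ υ π≈σ e) w

walk-trans : (π σ ρ : NC n) → Walk j π σ → Walk k σ ρ → Walk (j + k) π ρ
walk-trans π σ ρ (nil π≈σ)          w′ = walk-respˡ π σ ρ π≈σ w′
walk-trans π σ ρ (cons {σ = υ} e w) w′ = cons e (walk-trans υ σ ρ w w′)

walk-sym : (π ρ : NC n) → Walk k π ρ → Walk k ρ π
walk-sym π ρ (nil π≈ρ) = nil (≈-sym π ρ π≈ρ)
walk-sym {k = suc k} π ρ (cons {σ = σ} e w) = subst (λ k → Walk k ρ π) (ℕ.+-comm k 1)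
  (walk-trans ρ σ π (walk-sym σ ρ w) (cons {σ = π} (swap e) (nil (≈-refl π))))

-- As long as `τ` is not reached, some consecutive pair of a `τ`-class is still separated; merging
-- it is an edge that stays below `τ` and costs exactly one block.
walk-up : (π τ : NC n) → equiv π ⊑ equiv τ → ∃[ k ] (Walk k π τ × # equiv π ≡ k + # equiv τ)
walk-up {n} π τ = go (# equiv π) π refl
  where
  go : ∀ m (π : NC n) → # equiv π ≡ m → equiv π ⊑ equiv τ → ∃[ k ] (Walk k π τ × # equiv π ≡ k + # equiv τ)
  go m π #π π⊑τ with splitting-pair (equiv π) (equiv τ) π⊑τ
  ... | inj₁ τ⊑π = 0 , nil (⊑-antisym π τ π⊑τ τ⊑π) ,
        ℕ.≤-antisym (#-antitone (equiv τ) (equiv π) τ⊑π) (#-antitone (equiv π) (equiv τ) π⊑τ)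
  go zero π #π π⊑τ | inj₂ (x , y , c , ¬xy) = contradiction (trans (sym #π) (#-mergeNC π τ π⊑τ c ¬xy)) λ ()
  go (suc m) π #π π⊑τ | inj₂ (x , y , c , ¬xy)
    with go m (mergeNC π τ π⊑τ c ¬xy) (ℕ.suc-injective (trans (sym (#-mergeNC π τ π⊑τ c ¬xy)) #π)) (mergeNC⊑ π τ π⊑τ c ¬xy)
  ... | k , w , eq = suc k , cons (inj₁ (⋖mergeNC π τ π⊑τ c ¬xy)) w , trans (#-mergeNC π τ π⊑τ c ¬xy) (cong suc eq)

walk-via-upper : (π ρ τ : NC n) → equiv π ⊑ equiv τ → equiv ρ ⊑ equiv τ →
  ∃₂ λ j k → Walk (j + k) π ρ × # equiv π ≡ j + # equiv τ × # equiv ρ ≡ k + # equiv τ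
walk-via-upper π ρ τ π⊑τ ρ⊑τ with walk-up π τ π⊑τ | walk-up ρ τ ρ⊑τ
... | j , w , eq | k , w′ , eq′ = j , k , walk-trans π τ ρ w (walk-sym ρ τ w′) , eq , eq′

walk-via-lower : (π ρ τ : NC n) → equiv τ ⊑ equiv π → equiv τ ⊑ equiv ρ →
  ∃₂ λ j k → Walk (j + k) π ρ × # equiv τ ≡ j + # equiv π × # equiv τ ≡ k + # equiv ρ
walk-via-lower π ρ τ τ⊑π τ⊑ρ with walk-up τ π τ⊑π | walk-up τ ρ τ⊑ρ
... | j , w , eq | k , w′ , eq′ = j , k , walk-trans π τ ρ (walk-sym τ π w) w′ , eq , eq′

coarse : DecEquiv n
coarse = record
  { rel = λ _ _ → ⊤
  ; isDecEquivalence = record { isEquivalence = record { refl = tt ; sym = id ; trans = λ _ _ → tt } ; _≟_ = λ _ _ → yes tt } }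

discrete : DecEquiv n
discrete = record { rel = _≡_ ; isDecEquivalence = ≡.isDecEquivalence Fin._≟_ }

#-discrete : (R : DecEquiv n) → (∀ x y → rel R x y → x ≡ y) → # R ≡ n
#-discrete {zero}  R d = refl
#-discrete {suc n} R d = trans (#-isolated R λ (y , r) → contradiction (d zero (suc y) r) λ ())
  (cong suc (#-discrete (tail R) λ x y r → Fin.suc-injective (d (suc x) (suc y) r)))

-- J is the running join: an upward edge merges at most two of its classes and
-- a downward edge leaves it unchanged, so u bounds the drop of # J.
walk-merges : (σ ρ : NC n) → Walk k σ ρ → (J : DecEquiv n) → equiv σ ⊑ J →
  Σ (DecEquiv n) λ J′ → ∃₂ λ u v →
    J ⊑ J′ × equiv ρ ⊑ J′ × k ≡ u + v × # equiv σ + v ≡ # equiv ρ + u × # J ℕ.≤ # J′ + u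
walk-merges σ ρ (nil σ≈ρ) J σ⊑J = J , 0 , 0 , id , (λ r → σ⊑J (≈⇒⊒ σ ρ σ≈ρ r)) , refl
  , cong (_+ 0) (ℕ.≤-antisym (#-antitone (equiv ρ) (equiv σ) (≈⇒⊒ σ ρ σ≈ρ)) (#-antitone (equiv σ) (equiv ρ) (≈⇒⊑ σ ρ σ≈ρ)))
  , ℕ.≤-reflexive (sym (ℕ.+-identityʳ _))
walk-merges σ ρ (cons {σ = τ} (inj₁ σ⋖τ) w) J σ⊑J with ⋖⇒merge σ τ σ⋖τ
... | (x , y , τ⊑M) , #σ with walk-merges τ ρ w (merge J x y)
        (λ r → merge-least (equiv σ) (merge J x y) (λ s → merge-increasing J x y (σ⊑J s)) (merge-joins J x y) (τ⊑M r))
...   | J′ , u , v , J⊑ , ρ⊑ , eq , eq# , #≤ = J′ , suc u , v , (λ r → J⊑ (merge-increasing J x y r)) , ρ⊑ , cong suc eq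
    , trans (cong (_+ v) #σ) (trans (cong suc eq#) (sym (ℕ.+-suc _ u)))
    , ℕ.≤-trans (#-merge J x y) (ℕ.≤-trans (s≤s #≤) (ℕ.≤-reflexive (sym (ℕ.+-suc _ u))))
walk-merges σ ρ (cons {σ = τ} (inj₂ τ⋖σ) w) J σ⊑J with ⋖⇒merge τ σ τ⋖σ
... | _ , #τ with walk-merges τ ρ w J (λ r → σ⊑J (≺⇒⊑ τ σ (proj₁ τ⋖σ) r))
...   | J′ , u , v , J⊑ , ρ⊑ , eq , eq# , #≤ = J′ , u , suc v , J⊑ , ρ⊑ , trans (cong suc eq) (sym (ℕ.+-suc u v))
    , trans (ℕ.+-suc _ v) (trans (cong (_+ v) (sym #τ)) eq#) , #≤

-- `J` may be crossing, since the running join of `walk-merges` is built from arbitrary merges.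
Connected : DecEquiv n → DecEquiv n → Set₁
Connected R S = ∀ J → R ⊑ J → S ⊑ J → ∀ x y → rel J x y

coarse-nonCrossing : NonCrossing {n} coarse
coarse-nonCrossing _ _ _ _ _ = tt

discrete-nonCrossing : NonCrossing {n} discrete
discrete-nonCrossing a<b b<c _ refl _ = contradiction b<c (ℕ.<-asym a<b)

coarsest finest : ∀ n → NC n
coarsest n = fromEquiv coarse coarse-nonCrossing
finest n = fromEquiv discrete discrete-nonCrossing

⊑-coarsest : (π : NC n) → equiv π ⊑ equiv (coarsest n)
⊑-coarsest π {x} {y} _ = fromEquiv-⊒ coarse coarse-nonCrossing {x} {y} tt

#-coarsest : ∀ n → # equiv (coarsest (suc n)) ≡ 1
#-coarsest n = ℕ.≤-antisym (#-total (equiv (coarsest (suc n))) (λ x y → fromEquiv-⊒ coarse coarse-nonCrossing {x} {y} tt))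
  (#-positive (equiv (coarsest (suc n))))

finest-discrete : ∀ n x y → rel (equiv (finest n)) x y → x ≡ y
finest-discrete n x y = fromEquiv-⊑ discrete discrete-nonCrossing

finest-⊑ : (π : NC n) → equiv (finest n) ⊑ equiv π
finest-⊑ π {x} {y} r = subst (rel (equiv π) x) (finest-discrete _ x y r) (~refl (equiv π))

walk-via-coarsest : (π ρ : NC (suc n)) → ∃[ k ] (Walk k π ρ × # equiv π + # equiv ρ ≡ suc (suc k))
walk-via-coarsest {n} π ρ with walk-via-upper π ρ (coarsest (suc n)) (⊑-coarsest π) (⊑-coarsest ρ)
... | j , k , w , eq , eq′ = j + k , w
    , trans (cong₂ _+_ (trans eq (cong (j +_) (#-coarsest n))) (trans eq′ (cong (k +_) (#-coarsest n))))
        (solve 2 (λ j k → j :+ con 1 :+ (k :+ con 1) := con 2 :+ (j :+ k)) refl j k)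

connected⇒distance : (π ρ : NC (suc n)) → # equiv π + # equiv ρ ≡ suc (suc n) →
                     Connected (equiv π) (equiv ρ) → HasHasseDistance π ρ n
connected⇒distance {n} π ρ total conn = walk , shortest
  where
  walk : Walk n π ρ
  walk with walk-via-coarsest π ρ
  ... | k , w , eq = subst (λ k → Walk k π ρ) (ℕ.suc-injective (ℕ.suc-injective (trans (sym eq) total))) w

  shortest : ∀ j → Walk j π ρ → n ℕ.≤ j
  shortest j w with walk-merges π ρ w (equiv π) id
  ... | J , u , v , π⊑J , ρ⊑J , eq , eq# , #≤ = subst (n ℕ.≤_) (sym eq)
        (ℕ.≤-pred (ℕ.≤-pred (subst (ℕ._≤ 2 + (u + v)) total bound)))
    where
    -- The running join starts as `equiv π` and ends with a single class, which bounds `u` from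
    -- below; the balance `eq#` carries the bound over to `v`.
    #π : # equiv π ℕ.≤ suc u
    #π = ℕ.≤-trans #≤ (ℕ.+-monoˡ-≤ u (#-total J (conn J π⊑J ρ⊑J)))
    #ρ : # equiv ρ ℕ.≤ suc v
    #ρ = ℕ.+-cancelʳ-≤ u _ _ (ℕ.≤-trans (ℕ.≤-reflexive (sym eq#))
      (ℕ.≤-trans (ℕ.+-monoˡ-≤ v #π) (ℕ.≤-reflexive (cong suc (ℕ.+-comm u v)))))
    bound : # equiv π + # equiv ρ ℕ.≤ 2 + (u + v)
    bound = ℕ.≤-trans (ℕ.+-mono-≤ #π #ρ) (ℕ.≤-reflexive (cong suc (ℕ.+-suc u v)))

distance⇒# : (π ρ : NC (suc n)) → HasHasseDistance π ρ n → # equiv π + # equiv ρ ≡ suc (suc n)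
distance⇒# {n} π ρ (_ , shortest) = ℕ.≤-antisym upper lower
  where
  lower : suc (suc n) ℕ.≤ # equiv π + # equiv ρ
  lower with walk-via-coarsest π ρ
  ... | k , w , eq = ℕ.≤-trans (s≤s (s≤s (shortest k w))) (ℕ.≤-reflexive (sym eq))

  upper : # equiv π + # equiv ρ ℕ.≤ suc (suc n)
  upper with walk-via-lower π ρ (finest (suc n)) (finest-⊑ π) (finest-⊑ ρ)
  ... | j , k , w , eq , eq′ = ℕ.+-cancelˡ-≤ (j + k) _ _ (ℕ.≤-trans
        (ℕ.≤-reflexive (trans
          (solve 4 (λ j k p q → j :+ k :+ (p :+ q) := (j :+ p) :+ (k :+ q)) refl j k (# equiv π) (# equiv ρ))
          (cong₂ _+_ (trans (sym eq) #finest) (trans (sym eq′) #finest))))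
        (ℕ.≤-trans (ℕ.≤-reflexive (sym (ℕ.+-suc n (suc n)))) (ℕ.+-monoˡ-≤ (suc (suc n)) (shortest (j + k) w))))
    where
    #finest : # equiv (finest (suc n)) ≡ suc n
    #finest = #-discrete (equiv (finest (suc n))) (finest-discrete (suc n))

-- A walk up to the partition `τ` of `J` and down again has length |π| + |ρ| - 2|τ| = n + 2 - 2|τ|,
-- which is less than n once `τ` has two blocks. For `τ` to be a vertex, `J` has to be noncrossing.
distance⇒connected : (π ρ : NC (suc n)) → HasHasseDistance π ρ n →
  (J : DecEquiv (suc n)) → NonCrossing J → equiv π ⊑ J → equiv ρ ⊑ J → ∀ x y → rel J x y
distance⇒connected {n} π ρ dist@(_ , shortest) J nc π⊑J ρ⊑J x y =
  fromEquiv-⊑ J nc (#-injective (equiv τ) coarse (λ _ → tt) (ℕ.≤-trans #τ (#-positive (coarse {suc n}))) tt)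
  where
  τ = fromEquiv J nc
  #τ : # equiv τ ℕ.≤ 1
  #τ with walk-via-upper π ρ τ (λ r → fromEquiv-⊒ J nc (π⊑J r)) (λ r → fromEquiv-⊒ J nc (ρ⊑J r))
  ... | j , k , w , eq , eq′ = ℕ.≮⇒≥ λ 2≤ → ℕ.<⇒≱ (ℕ.+-mono-≤ 2≤ 2≤) (ℕ.+-cancelˡ-≤ (j + k) (# equiv τ + # equiv τ) _
        (ℕ.≤-trans (ℕ.≤-reflexive (trans
           (trans (solve 3 (λ j k p → j :+ k :+ (p :+ p) := (j :+ p) :+ (k :+ p)) refl j k (# equiv τ))
             (cong₂ _+_ (sym eq) (sym eq′))) (distance⇒# π ρ dist)))
          (ℕ.≤-trans (s≤s (s≤s (shortest (j + k) w))) (ℕ.≤-trans (ℕ.n≤1+n _) (ℕ.≤-reflexive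
             (solve 1 (λ m → con 3 :+ m := m :+ con 3) refl (j + k)))))))

-- Positions in lists

data At {A : Set} : List A → ℕ → A → Set where
  here  : ∀ {x xs} → At (x ∷ xs) 0 x
  there : ∀ {x xs k v} → At xs k v → At (x ∷ xs) (suc k) v

module _ {A : Set} where

  At-functional : ∀ {xs k} {v w : A} → At xs k v → At xs k w → v ≡ w
  At-functional here      here      = refl
  At-functional (there p) (there q) = At-functional p q

  At-< : ∀ {xs k} {v : A} → At xs k v → k ℕ.< length xs
  At-< here      = s≤s z≤n
  At-< (there p) = s≤s (At-< p)

  At-total : ∀ (xs : List A) {k} → k ℕ.< length xs → ∃[ v ] At xs k v
  At-total (x ∷ xs) {zero}  _       = x , here
  At-total (x ∷ xs) {suc k} (s≤s p) with At-total xs p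
  ... | v , q = v , there q

  At-drop : ∀ m {xs k} {v : A} → At (drop m xs) k v → At xs (m + k) v
  At-drop zero             p = p
  At-drop (suc m) {_ ∷ xs} p = there (At-drop m p)

  At-map : ∀ {B : Set} (f : A → B) {xs k} {v : A} → At xs k v → At (List.map f xs) k (f v)
  At-map f here      = here
  At-map f (there p) = there (At-map f p)

  At-map⁻ : ∀ {B : Set} (f : A → B) {xs k} {w : B} → At (List.map f xs) k w → ∃[ v ] (w ≡ f v × At xs k v)
  At-map⁻ f {x ∷ xs} here      = x , refl , here
  At-map⁻ f {x ∷ xs} (there p) with At-map⁻ f p
  ... | v , eq , q = v , eq , there q

  All-At : ∀ {P : A → Set} {xs k v} → All P xs → At xs k v → P v
  All-At (p ∷ _)  here      = p
  All-At (_ ∷ ps) (there q) = All-At ps q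

  AllPairs-At : ∀ {P : A → A → Set} {xs k v} → AllPairs P xs → At xs k v → All (P v) (drop (suc k) xs)
  AllPairs-At (p ∷ _)  here      = p
  AllPairs-At (_ ∷ ps) (there q) = AllPairs-At ps q

  At-split : ∀ {xs i k} {u v : A} → At xs i u → At xs k v → i ℕ.< k → ∃[ m ] At (drop (suc i) xs) m v
  At-split here (there q) _ = _ , q
  At-split (there p) (there q) (s≤s i<k) = At-split p q i<k

-- Noncrossing partitions

-- A noncrossing partition is built from right to left.  The visible points are
-- the least elements of the classes that no arc passes over; an entry just k
-- joins the new point 0 to the k-th visible point and hides those before it.
visible : Vec (Maybe ℕ) n → List (Fin n)
visible []             = []
visible (nothing ∷ ds) = zero ∷ List.map suc (visible ds)
visible (just k ∷ ds)  = zero ∷ List.map suc (drop (suc k) (visible ds))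

data Links : ∀ {n} → Vec (Maybe ℕ) n → DecEquiv n → Set₁ where
  []       : ∀ {S} → Links [] S
  isolated : ∀ {n} {ds : Vec _ n} {S} → ¬ Linked S → Links ds (tail S) → Links (nothing ∷ ds) S
  joined   : ∀ {n} {ds : Vec _ n} {S k v} → At (visible ds) k v → rel S zero (suc v) →
             Links ds (tail S) → Links (just k ∷ ds) S

visible-increasing : (ds : Vec (Maybe ℕ) n) → AllPairs Fin._<_ (visible ds)
visible-increasing []             = []
visible-increasing (nothing ∷ ds) = All.map⁺ (All.universal (λ _ → s≤s z≤n) _) ∷
  AllPairs.map⁺ (AllPairs.map s≤s (visible-increasing ds))
visible-increasing (just k ∷ ds) = All.map⁺ (All.universal (λ _ → s≤s z≤n) _) ∷
  AllPairs.map⁺ (AllPairs.map s≤s (AllPairs.drop⁺ (suc k) (visible-increasing ds)))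

visible-distinct : {ds : Vec (Maybe ℕ) n} {S : DecEquiv n} → Links ds S → AllPairs (λ u v → ¬ rel S u v) (visible ds)
visible-distinct [] = []
visible-distinct (isolated ¬l ls) = All.map⁺ (All.universal (λ y r → ¬l (y , r)) _) ∷ AllPairs.map⁺ (visible-distinct ls)
visible-distinct {S = S} (joined {k = k} at 0v ls) =
  All.map⁺ (All.map (λ ¬r r → ¬r (~trans S (~sym S 0v) r)) (AllPairs-At (visible-distinct ls) at)) ∷
  AllPairs.map⁺ (AllPairs.drop⁺ (suc k) (visible-distinct ls))

visible-minimal : {ds : Vec (Maybe ℕ) n} {S : DecEquiv n} → Links ds S →
                  All (λ v → ∀ c → rel S v c → v Fin.≤ c) (visible ds)
visible-minimal [] = []
visible-minimal {S = S} (isolated ¬l ls) = (λ _ _ → z≤n) ∷ All.map⁺ (All.map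
  (λ min → λ { zero r → contradiction (_ , ~sym S r) ¬l ; (suc c) r → s≤s (min c r) }) (visible-minimal ls))
visible-minimal {S = S} (joined {k = k} at 0v ls) = (λ _ _ → z≤n) ∷ All.map⁺ (All.zipWith
  (λ (¬r , min) → λ { zero r → contradiction (~trans S (~sym S 0v) (~sym S r)) ¬r ; (suc c) r → s≤s (min c r) })
  (AllPairs-At (visible-distinct ls) at , All.drop⁺ (suc k) (visible-minimal ls)))

-- A new point joined to a visible `v` makes an arc to every `c` in the class of `v`. What is
-- required here is precisely that no older arc from `b` to `d` crosses such an arc.
visible-uncrossed : {ds : Vec (Maybe ℕ) n} {S : DecEquiv n} → Links ds S →
  All (λ v → ∀ {b c d} → b Fin.< c → c Fin.< d → rel S v c → rel S b d → rel S b v) (visible ds)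
visible-uncrossed [] = []
visible-uncrossed {S = S} (isolated ¬l ls) =
  (λ { {c = suc c} _ _ 0c _ → contradiction (_ , 0c) ¬l }) ∷
  All.map⁺ (All.map (λ un → λ { {zero} {suc c} {suc d} _ _ _ 0d → contradiction (d , 0d) ¬l
                              ; {suc b} {suc c} {suc d} (s≤s b<c) (s≤s c<d) vc bd → un b<c c<d vc bd })
    (visible-uncrossed ls))
visible-uncrossed {S = S} (joined {k = k} {v} at 0v ls) =
  (λ { {zero} _ _ _ _ → ~refl S
     ; {suc b} {suc c} {suc d} (s≤s b<c) (s≤s c<d) 0c bd →
         ~trans S (All-At (visible-uncrossed ls) at b<c c<d (~trans S (~sym S 0v) 0c) bd) (~sym S 0v) }) ∷
  All.map⁺ (All.zipWith
    (λ ((¬vw , v<w) , un , min) → λ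
      -- The arc that leaves `zero` can be replaced by one that leaves `v`: visible points increase
      -- and `w` is least in its class, so v < w ≤ c, and the induction hypothesis would relate `v`
      -- to `w`.
      { {zero} {suc c} {suc d} _ (s≤s c<d) wc 0d →
          contradiction (un (ℕ.<-≤-trans v<w (min c wc)) c<d wc (~trans S (~sym S 0v) 0d)) ¬vw
      ; {suc b} {suc c} {suc d} (s≤s b<c) (s≤s c<d) wc bd → un b<c c<d wc bd })
    ( All.zip (AllPairs-At (visible-distinct ls) at , AllPairs-At (visible-increasing _) at)
    , All.zip (All.drop⁺ (suc k) (visible-uncrossed ls) , All.drop⁺ (suc k) (visible-minimal ls))))

links-nonCrossing : {ds : Vec (Maybe ℕ) n} {S : DecEquiv n} → Links ds S → NonCrossing S
links-nonCrossing {S = S} ls {suc a} {suc b} {suc c} {suc d} (s≤s a<b) (s≤s b<c) (s≤s c<d) ac bd with ls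
... | isolated _ ls′ = links-nonCrossing ls′ a<b b<c c<d ac bd
... | joined _ _ ls′ = links-nonCrossing ls′ a<b b<c c<d ac bd
links-nonCrossing {S = S} (isolated ¬l ls) {zero} {suc b} {suc c} {suc d} _ b<c c<d 0c bd = contradiction (c , 0c) ¬l
links-nonCrossing {S = S} (joined at 0v ls) {zero} {suc b} {suc c} {suc d} _ (s≤s b<c) (s≤s c<d) 0c bd =
  ~trans S 0v (~sym S (All-At (visible-uncrossed ls) at b<c c<d (~trans S (~sym S 0v) 0c) bd))

Covered : DecEquiv n → Fin n → Set
Covered S y = ∃₂ λ u v → u Fin.< y × y Fin.< v × rel S u v × ¬ rel S u y

covered-suc : (S : DecEquiv (suc n)) {y : Fin n} → Covered (tail S) y → Covered S (suc y)
covered-suc S (u , v , u<y , y<v , uv , ¬uy) = suc u , suc v , s≤s u<y , s≤s y<v , uv , ¬uy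

-- A class leaves the visible list only when a join at a later position hides it, and then its
-- visible point lies under the new arc from `zero` to `v`. The class of `v` itself stays visible
-- through `zero`.
visible-or-covered : {ds : Vec (Maybe ℕ) n} {S : DecEquiv n} → Links ds S →
  ∀ y → ∃[ z ] (rel S y z × ((∃[ k ] At (visible ds) k z) ⊎ Covered S z))
visible-or-covered {ds = nothing ∷ _} {S} ls zero = zero , ~refl S , inj₁ (0 , here)
visible-or-covered {ds = just _ ∷ _} {S} ls zero = zero , ~refl S , inj₁ (0 , here)
visible-or-covered {S = S} (isolated ¬l ls) (suc y) with visible-or-covered ls y
... | z , yz , inj₁ (k , at) = suc z , yz , inj₁ (suc k , there (At-map suc at))
... | z , yz , inj₂ cov = suc z , yz , inj₂ (covered-suc S cov)
visible-or-covered {S = S} (joined {k = k} {v} at 0v ls) (suc y) with visible-or-covered ls y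
... | z , yz , inj₂ cov = suc z , yz , inj₂ (covered-suc S cov)
... | z , yz , inj₁ (i , at′) with ℕ.<-cmp i k
...   | tri≈ _ refl _ with At-functional at at′
...     | refl = zero , ~trans S yz (~sym S 0v) , inj₁ (0 , here)
visible-or-covered {S = S} (joined {k = k} {v} at 0v ls) (suc y) | z , yz , inj₁ (i , at′) | tri< i<k _ _
  with At-split at′ at i<k
... | m , at″ = suc z , yz , inj₂ (zero , suc v , s≤s z≤n
      , s≤s (All-At (AllPairs-At (visible-increasing _) at′) at″) , 0v
      , λ 0z → All-At (AllPairs-At (visible-distinct ls) at′) at″ (~trans S (~sym S 0z) 0v))
visible-or-covered {S = S} (joined {k = k} {v} at 0v ls) (suc y) | z , yz , inj₁ (i , at′) | tri> _ _ k<i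
  with At-split at at′ k<i
... | m , at″ = suc z , yz , inj₁ (suc m , there (At-map suc at″))

-- An arc from `zero` to a covered point would cross the arc that covers it.
joins-visible : {ds : Vec (Maybe ℕ) n} (S : DecEquiv (suc n)) → NonCrossing S → Links ds (tail S) → Linked S →
                ∃₂ λ k v → At (visible ds) k v × rel S zero (suc v)
joins-visible S nc ls (y , 0y) with visible-or-covered ls y
... | z , yz , inj₁ (k , at) = k , z , at , ~trans S 0y yz
... | z , yz , inj₂ (u , v , u<z , z<v , uv , ¬uz) = contradiction
      (~trans S (~sym S (nc (s≤s z≤n) (s≤s u<z) (s≤s z<v) (~trans S 0y yz) uv)) (~trans S 0y yz)) ¬uz

links-injective : {ds : Vec (Maybe ℕ) n} {S : DecEquiv n} → Links ds S → ∀ {i k u v} →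
                  At (visible ds) i u → At (visible ds) k v → rel S u v → i ≡ k
links-injective {S = S} ls {i} {k} atu atv uv with ℕ.<-cmp i k
... | tri≈ _ eq _ = eq
... | tri< i<k _ _ = contradiction uv (All-At (AllPairs-At (visible-distinct ls) atu) (proj₂ (At-split atu atv i<k)))
... | tri> _ _ k<i = contradiction (~sym S uv) (All-At (AllPairs-At (visible-distinct ls) atv) (proj₂ (At-split atv atu k<i)))

-- Trees of pairs of partitions

-- cyc closes a cycle of the block graph.  It occurs for general pairs and is
-- excluded by the number of blocks only.
data Move : Set where
  leaf : Move
  node : (a e : ℕ) → Move
  cyc  : (e : ℕ) → Move

depth : Move → Maybe ℕ
depth leaf       = nothing
depth (node a e) = just (a + e)
depth (cyc e)    = just e

depths : Vec Move n → Vec (Maybe ℕ) n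
depths = Vec.map depth

-- The list describes the components of the block graph of R and S from left to
-- right, an entry g standing for a component with g + 1 visible S-classes.
-- The new point 0 starts a new R-class (new-) or continues the R-class of its
-- right neighbour (cont-), and is isolated in S (-new) or joined to an S-class
-- of the first (new-join, cont-cycle) or second (cont-join) component; joining
-- a later one would leave a component with no visible class.
data Models : ∀ {n} → List ℕ → Vec Move n → DecEquiv n → DecEquiv n → Set₁ where
  empty      : ∀ {R S} → Models [] [] R S
  new-new    : ∀ {n gs R S} {ms : Vec Move n} → ¬ Linked R → ¬ Linked S →
               Models gs ms (tail R) (tail S) → Models (0 ∷ gs) (leaf ∷ ms) R S
  cont-new   : ∀ {n g gs R S} {ms : Vec Move n} → Linked R → ¬ Linked S →
               Models (g ∷ gs) ms (tail R) (tail S) → Models (suc g ∷ gs) (leaf ∷ ms) R S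
  new-join   : ∀ {n e h gs R S v} {ms : Vec Move n} → ¬ Linked R →
               At (visible (depths ms)) e v → rel S zero (suc v) →
               Models (e + h ∷ gs) ms (tail R) (tail S) → Models (h ∷ gs) (node 0 e ∷ ms) R S
  cont-join  : ∀ {n a e h gs R S v} {ms : Vec Move n} → Linked R →
               At (visible (depths ms)) (suc a + e) v → rel S zero (suc v) →
               Models (a ∷ e + h ∷ gs) ms (tail R) (tail S) → Models (h ∷ gs) (node (suc a) e ∷ ms) R S
  cont-cycle : ∀ {n e h gs R S v} {ms : Vec Move n} → Linked R →
               At (visible (depths ms)) e v → rel S zero (suc v) →
               Models (e + h ∷ gs) ms (tail R) (tail S) → Models (h ∷ gs) (cyc e ∷ ms) R S

private variable
  st st′ : List ℕ
  ms ms′ : Vec Move n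
  R S R′ S′ : DecEquiv n

models-links : Models st ms R S → Links (depths ms) S
models-links empty                  = []
models-links (new-new _ ¬s m)       = isolated ¬s (models-links m)
models-links (cont-new _ ¬s m)      = isolated ¬s (models-links m)
models-links (new-join _ at 0v m)   = joined at 0v (models-links m)
models-links (cont-join _ at 0v m)  = joined at 0v (models-links m)
models-links (cont-cycle _ at 0v m) = joined at 0v (models-links m)

-- Components of the block graph

size : List ℕ → ℕ
size []       = 0
size (g ∷ gs) = suc g + size gs

size-split : ∀ e h gs → size (e + h ∷ gs) ≡ e + size (h ∷ gs)
size-split e h gs = solve 3 (λ e h s → con 1 :+ (e :+ h :+ s) := e :+ (con 1 :+ (h :+ s))) refl e h (size gs)

length-rest : ∀ k {l} (xs : List (Fin n)) → length xs ≡ k + suc l → length (List.map Fin.suc (drop (suc k) xs)) ≡ l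
length-rest k {l} xs eq = trans (length-map Fin.suc (drop (suc k) xs)) (trans (length-drop (suc k) xs)
  (trans (cong (ℕ._∸ suc k) (trans eq (ℕ.+-suc k l))) (ℕ.m+n∸m≡n (suc k) l)))

models-size : Models st ms R S → length (visible (depths ms)) ≡ size st
models-size empty = refl
models-size (new-new {ms = ms} _ _ m) = cong suc (trans (length-map Fin.suc (visible (depths ms))) (models-size m))
models-size (cont-new {ms = ms} _ _ m) = cong suc (trans (length-map Fin.suc (visible (depths ms))) (models-size m))
models-size (new-join {e = e} {h} {gs} {ms = ms} _ at _ m) = cong suc (length-rest e (visible (depths ms)) (trans (models-size m) (size-split e h gs)))
models-size (cont-cycle {e = e} {h} {gs} {ms = ms} _ at _ m) = cong suc (length-rest e (visible (depths ms)) (trans (models-size m) (size-split e h gs)))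
models-size (cont-join {a = a} {e} {h} {gs} {ms = ms} _ at _ m) = cong suc (length-rest (suc a + e) (visible (depths ms)) (trans (models-size m)
  (trans (cong (suc a +_) (size-split e h gs)) (sym (ℕ.+-assoc (suc a) e _)))))

-- The number of the component that owns the `k`-th visible class, where an entry `g` owns `suc g`
-- successive positions. Positions past the end get a default.
index : List ℕ → ℕ → ℕ
index []           k       = 0
index (g ∷ gs)     zero    = 0
index (zero ∷ gs)  (suc k) = suc (index gs k)
index (suc g ∷ gs) (suc k) = index (g ∷ gs) k

index-split : ∀ e h gs i → index (e + h ∷ gs) (e + i) ≡ index (h ∷ gs) i
index-split zero    h gs i = refl
index-split (suc e) h gs i = index-split e h gs i

index-beyond : ∀ a gs i → index (a ∷ gs) (suc a + i) ≡ suc (index gs i)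
index-beyond zero    gs i = refl
index-beyond (suc a) gs i = index-beyond a gs i

index-within : ∀ e h gs → index (e + h ∷ gs) e ≡ 0
index-within e h gs = trans (cong (index (e + h ∷ gs)) (sym (ℕ.+-identityʳ e))) (index-split e h gs 0)

-- Components are runs of consecutive points, numbered from the left.
component : Models {n} st ms R S → Fin n → ℕ
component (new-new _ _ m)      zero    = 0
component (new-new _ _ m)      (suc x) = suc (component m x)
component (cont-new _ _ m)     zero    = 0
component (cont-new _ _ m)     (suc x) = component m x
component (new-join _ _ _ m)   zero    = 0
component (new-join _ _ _ m)   (suc x) = component m x
component (cont-join _ _ _ m)  zero    = 0
component (cont-join _ _ _ m)  (suc x) = pred (component m x)
component (cont-cycle _ _ _ m) zero    = 0
component (cont-cycle _ _ _ m) (suc x) = component m x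

component-zero : (m : Models {suc n} st ms R S) → component m zero ≡ 0
component-zero (new-new _ _ m)      = refl
component-zero (cont-new _ _ m)     = refl
component-zero (new-join _ _ _ m)   = refl
component-zero (cont-join _ _ _ m)  = refl
component-zero (cont-cycle _ _ _ m) = refl

component-visible : (m : Models st ms R S) → ∀ {k v} → At (visible (depths ms)) k v → component m v ≡ index st k
component-visible (new-new _ _ m) here = refl
component-visible (new-new _ _ m) (there at) with At-map⁻ suc at
... | v , refl , at′ = cong suc (component-visible m at′)
component-visible (cont-new _ _ m) here = refl
component-visible (cont-new _ _ m) (there at) with At-map⁻ suc at
... | v , refl , at′ = component-visible m at′
component-visible (new-join _ _ _ m) here = refl
component-visible (new-join {e = e} {h} {gs} _ _ _ m) (there {k = k} at) with At-map⁻ suc at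
... | v , refl , at′ = trans (component-visible m (At-drop (suc e) at′))
      (trans (cong (index (e + h ∷ gs)) (sym (ℕ.+-suc e k))) (index-split e h gs (suc k)))
component-visible (cont-cycle _ _ _ m) here = refl
component-visible (cont-cycle {e = e} {h} {gs} _ _ _ m) (there {k = k} at) with At-map⁻ suc at
... | v , refl , at′ = trans (component-visible m (At-drop (suc e) at′))
      (trans (cong (index (e + h ∷ gs)) (sym (ℕ.+-suc e k))) (index-split e h gs (suc k)))
component-visible (cont-join _ _ _ m) here = refl
component-visible (cont-join {a = a} {e} {h} {gs} _ _ _ m) (there {k = k} at) with At-map⁻ suc at
... | v , refl , at′ = trans (cong pred (trans (component-visible m (At-drop (suc (suc a + e)) at′))
        (trans (cong (index (a ∷ e + h ∷ gs))
                 (solve 3 (λ a e k → con 2 :+ a :+ e :+ k := con 1 :+ a :+ (e :+ (con 1 :+ k))) refl a e k))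
               (index-beyond a (e + h ∷ gs) (e + suc k)))))
      (index-split e h gs (suc k))

component-monotone : (m : Models {n} st ms R S) → ∀ {x y} → x Fin.≤ y → component m x ℕ.≤ component m y
component-monotone m {zero} {y} _ = subst (ℕ._≤ component m y) (sym (component-zero m)) z≤n
component-monotone (new-new _ _ m)      {suc x} {suc y} (s≤s x≤y) = s≤s (component-monotone m x≤y)
component-monotone (cont-new _ _ m)     {suc x} {suc y} (s≤s x≤y) = component-monotone m x≤y
component-monotone (new-join _ _ _ m)   {suc x} {suc y} (s≤s x≤y) = component-monotone m x≤y
component-monotone (cont-join _ _ _ m)  {suc x} {suc y} (s≤s x≤y) = ℕ.pred-mono-≤ (component-monotone m x≤y)
component-monotone (cont-cycle _ _ _ m) {suc x} {suc y} (s≤s x≤y) = component-monotone m x≤y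

-- A convex class that contains `zero` and a later point contains the right neighbour of `zero`.
-- Hence a convex relation is determined by which points are linked at all.
convex-next : (R : DecEquiv (suc (suc n))) → Convex R → ∀ {y} → rel R zero (suc y) → rel (tail R) zero y
convex-next R cv {y} r = ~trans R (~sym R (cv z≤n (s≤s z≤n) r)) r

component-rel : (R : DecEquiv n) → Convex R → (m : Models {n} st ms R S) →
                ∀ {x y} → rel R x y → component m x ≡ component m y
component-next : (R : DecEquiv (suc n)) → Convex R → (m : Models {n} st ms (tail R) S) →
                 ∀ {y} → rel R zero (suc y) → component m y ≡ 0
component-rel-zero : (R : DecEquiv (suc n)) → Convex R → (m : Models {suc n} st ms R S) →
                     ∀ {y} → rel R zero (suc y) → 0 ≡ component m (suc y)

component-next {n = suc n} R cv m r =
  trans (sym (component-rel (tail R) (tail-convex R cv) m (convex-next R cv r))) (component-zero m)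

component-rel-zero R cv (new-new ¬l _ m)      r = contradiction (_ , r) ¬l
component-rel-zero R cv (cont-new _ _ m)      r = sym (component-next R cv m r)
component-rel-zero R cv (new-join ¬l _ _ m)   r = contradiction (_ , r) ¬l
component-rel-zero R cv (cont-join _ _ _ m)   r = sym (cong pred (component-next R cv m r))
component-rel-zero R cv (cont-cycle _ _ _ m)  r = sym (component-next R cv m r)

component-rel R cv m {zero} {zero} r = refl
component-rel R cv m {zero} {suc y} r = trans (component-zero m) (component-rel-zero R cv m r)
component-rel R cv m {suc x} {zero} r = sym (trans (component-zero m) (component-rel-zero R cv m (~sym R r)))
component-rel R cv (new-new _ _ m) {suc x} {suc y} r = cong suc (component-rel (tail R) (tail-convex R cv) m r)
component-rel R cv (cont-new _ _ m) {suc x} {suc y} r = component-rel (tail R) (tail-convex R cv) m r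
component-rel R cv (new-join _ _ _ m) {suc x} {suc y} r = component-rel (tail R) (tail-convex R cv) m r
component-rel R cv (cont-join _ _ _ m) {suc x} {suc y} r = cong pred (component-rel (tail R) (tail-convex R cv) m r)
component-rel R cv (cont-cycle _ _ _ m) {suc x} {suc y} r = component-rel (tail R) (tail-convex R cv) m r

component-link : (S : DecEquiv n) (m : Models {n} st ms R S) → ∀ {x y} → rel S x y → component m x ≡ component m y
component-link-zero : (S : DecEquiv (suc n)) (m : Models {suc n} st ms R S) →
                      ∀ {y} → rel S zero (suc y) → 0 ≡ component m (suc y)

component-link-zero S (new-new _ ¬l m) r = contradiction (_ , r) ¬l
component-link-zero S (cont-new _ ¬l m) r = contradiction (_ , r) ¬l
component-link-zero S (new-join {e = e} {h} {gs} _ at 0v m) r =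
  sym (trans (component-link (tail S) m (~trans S (~sym S r) 0v)) (trans (component-visible m at) (index-within e h gs)))
component-link-zero S (cont-cycle {e = e} {h} {gs} _ at 0v m) r =
  sym (trans (component-link (tail S) m (~trans S (~sym S r) 0v)) (trans (component-visible m at) (index-within e h gs)))
component-link-zero S (cont-join {a = a} {e} {h} {gs} _ at 0v m) r =
  sym (cong pred (trans (component-link (tail S) m (~trans S (~sym S r) 0v))
    (trans (component-visible m at) (trans (index-beyond a (e + h ∷ gs) e) (cong suc (index-within e h gs))))))

component-link S m {zero} {zero} r = refl
component-link S m {zero} {suc y} r = trans (component-zero m) (component-link-zero S m r)
component-link S m {suc x} {zero} r = sym (trans (component-zero m) (component-link-zero S m (~sym S r)))
component-link S (new-new _ _ m) {suc x} {suc y} r = cong suc (component-link (tail S) m r)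
component-link S (cont-new _ _ m) {suc x} {suc y} r = component-link (tail S) m r
component-link S (new-join _ _ _ m) {suc x} {suc y} r = component-link (tail S) m r
component-link S (cont-join _ _ _ m) {suc x} {suc y} r = cong pred (component-link (tail S) m r)
component-link S (cont-cycle _ _ _ m) {suc x} {suc y} r = component-link (tail S) m r

component-< : (m : Models {n} st ms R S) → ∀ x → component m x ℕ.< length st
component-< (new-new _ _ m)      zero    = s≤s z≤n
component-< (cont-new _ _ m)     zero    = s≤s z≤n
component-< (new-join _ _ _ m)   zero    = s≤s z≤n
component-< (cont-join _ _ _ m)  zero    = s≤s z≤n
component-< (cont-cycle _ _ _ m) zero    = s≤s z≤n
component-< (new-new _ _ m)      (suc x) = s≤s (component-< m x)
component-< (cont-new _ _ m)     (suc x) = component-< m x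
component-< (new-join _ _ _ m)   (suc x) = component-< m x
component-< (cont-join _ _ _ m)  (suc x) = s≤s (ℕ.pred-mono-≤ (ℕ.≤-pred (component-< m x)))
component-< (cont-cycle _ _ _ m) (suc x) = component-< m x

component-onto : (m : Models {n} st ms R S) → ∀ {i} → i ℕ.< length st → ∃[ x ] component m x ≡ i
component-onto (new-new _ _ m) {zero} _ = zero , refl
component-onto (new-new _ _ m) {suc i} (s≤s i<) with component-onto m i<
... | x , eq = suc x , cong suc eq
component-onto (cont-new _ _ m) i< with component-onto m i<
... | x , eq = suc x , eq
component-onto (new-join _ _ _ m) i< with component-onto m i<
... | x , eq = suc x , eq
component-onto (cont-cycle _ _ _ m) i< with component-onto m i<
... | x , eq = suc x , eq
component-onto (cont-join _ _ _ m) {i} i< with component-onto m (s≤s i<)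
... | x , eq = suc x , cong pred eq

-- `cont-join` merges components 0 and 1 and renumbers the later ones; `pred` does both, and this
-- describes which numbers it identifies.
pred-≡ : ∀ i j → pred i ≡ pred j → i ≡ j ⊎ (i ℕ.≤ 1 × j ℕ.≤ 1)
pred-≡ zero          zero          _    = inj₁ refl
pred-≡ zero          (suc zero)    _    = inj₂ (z≤n , ℕ.≤-refl)
pred-≡ (suc zero)    zero          _    = inj₂ (ℕ.≤-refl , z≤n)
pred-≡ (suc i)       (suc j)       refl = inj₁ refl


-- The converse of `component-rel` and `component-link`: components are exactly the classes of the
-- join. The new point is attached through its `R`-link or its `S`-link, and `cont-join` uses both.
component-connected : (R : DecEquiv n) → Convex R → (m : Models {n} st ms R S) → (J : DecEquiv n) → R ⊑ J → S ⊑ J →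
                      ∀ {x y} → component m x ≡ component m y → rel J x y
component-connected-zero : (R : DecEquiv (suc n)) → Convex R → (m : Models {suc n} st ms R S) →
                           (J : DecEquiv (suc n)) → R ⊑ J → S ⊑ J →
                           ∀ {y} → component m (suc y) ≡ 0 → rel J zero (suc y)

component-connected-zero R cv (cont-new (z , r) _ m) J R⊑J S⊑J eq =
  ~trans J (R⊑J r) (component-connected (tail R) (tail-convex R cv) m (tail J) R⊑J S⊑J
    (trans (component-next R cv m r) (sym eq)))
component-connected-zero R cv (cont-cycle (z , r) _ _ m) J R⊑J S⊑J eq =
  ~trans J (R⊑J r) (component-connected (tail R) (tail-convex R cv) m (tail J) R⊑J S⊑J
    (trans (component-next R cv m r) (sym eq)))
component-connected-zero R cv (new-join {e = e} {h} {gs} _ at 0v m) J R⊑J S⊑J eq =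
  ~trans J (S⊑J 0v) (component-connected (tail R) (tail-convex R cv) m (tail J) R⊑J S⊑J
    (trans (component-visible m at) (trans (index-within e h gs) (sym eq))))
component-connected-zero R cv (cont-join {a = a} {e} {h} {gs} {v = v} (z , r) at 0v m) J R⊑J S⊑J {y} eq
  -- `eq` leaves only 0 and 1 for the component of `y`, the two that meet in `zero`: its `R`-link
  -- leads into component 0 and its `S`-link into component 1.
  with component m y in c
... | zero     = ~trans J (R⊑J r) (component-connected (tail R) (tail-convex R cv) m (tail J) R⊑J S⊑J
                   (trans (component-next R cv m r) (sym c)))
... | suc zero = ~trans J (S⊑J 0v) (component-connected (tail R) (tail-convex R cv) m (tail J) R⊑J S⊑J
                   (trans (component-visible m at) (trans (index-beyond a (e + h ∷ gs) e)
                     (trans (cong suc (index-within e h gs)) (sym c)))))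

component-connected R cv m J R⊑J S⊑J {zero} {zero} eq = ~refl J
component-connected R cv m J R⊑J S⊑J {zero} {suc y} eq =
  component-connected-zero R cv m J R⊑J S⊑J (trans (sym eq) (component-zero m))
component-connected R cv m J R⊑J S⊑J {suc x} {zero} eq =
  ~sym J (component-connected-zero R cv m J R⊑J S⊑J (trans eq (component-zero m)))
component-connected R cv (new-new _ _ m) J R⊑J S⊑J {suc x} {suc y} eq =
  component-connected (tail R) (tail-convex R cv) m (tail J) R⊑J S⊑J (ℕ.suc-injective eq)
component-connected R cv (cont-new _ _ m) J R⊑J S⊑J {suc x} {suc y} eq =
  component-connected (tail R) (tail-convex R cv) m (tail J) R⊑J S⊑J eq
component-connected R cv (new-join _ _ _ m) J R⊑J S⊑J {suc x} {suc y} eq =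
  component-connected (tail R) (tail-convex R cv) m (tail J) R⊑J S⊑J eq
component-connected R cv (cont-cycle _ _ _ m) J R⊑J S⊑J {suc x} {suc y} eq =
  component-connected (tail R) (tail-convex R cv) m (tail J) R⊑J S⊑J eq
component-connected R cv m@(cont-join _ _ _ m′) J R⊑J S⊑J {suc x} {suc y} eq
  with pred-≡ (component m′ x) (component m′ y) eq
... | inj₁ eq′ = component-connected (tail R) (tail-convex R cv) m′ (tail J) R⊑J S⊑J eq′
-- Both points lie in the components that `zero` has merged, so they are connected through `zero`.
... | inj₂ (x≤1 , y≤1) = ~trans J
      (~sym J (component-connected-zero R cv m J R⊑J S⊑J (ℕ.n≤0⇒n≡0 (ℕ.pred-mono-≤ x≤1))))
      (component-connected-zero R cv m J R⊑J S⊑J (ℕ.n≤0⇒n≡0 (ℕ.pred-mono-≤ y≤1)))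

-- Closed intervals and the reading of a pair

record ClosedInterval (R S : DecEquiv n) : Set₁ where
  field
    In     : Fin n → Set
    in?    : ∀ x → Dec (In x)
    convex : ∀ {x y z} → x Fin.≤ y → y Fin.≤ z → In x → In z → In y
    closedˡ : ∀ {x y} → rel R x y → In x → In y
    closedʳ : ∀ {x y} → rel S x y → In x → In y
    member  : ∃ In

-- An arc of S passes over such an interval, so points added on the left can
-- never connect it to the rest.
record DeadInterval (R S : DecEquiv n) : Set₁ where
  field
    interval : ClosedInterval R S
  open ClosedInterval interval public
  field
    u v   : Fin n
    arc   : rel S u v
    u<In  : ∀ {x} → In x → u Fin.< x
    In<v  : ∀ {x} → In x → x Fin.< v

  u∉In : ¬ In u
  u∉In i = ℕ.<-irrefl refl (u<In i)

-- An `R`-link from `zero` into the interval would include `u` by convexity, and an `S`-link would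
-- cross the arc from `u` to `v` unless `u` were in its class. Either way `u` would be in the
-- interval.
dead-suc : (R S : DecEquiv (suc n)) → Convex R → NonCrossing S → DeadInterval (tail R) (tail S) → DeadInterval R S
dead-suc {n} R S cv nc D = record
  { interval = record
    { In = In′ ; in? = in?′ ; convex = convex′ ; closedˡ = closedˡ′ ; closedʳ = closedʳ′
    ; member = suc (proj₁ member) , proj₂ member }
  ; u = suc u ; v = suc v ; arc = arc
  ; u<In = λ { {suc x} i → s≤s (u<In i) } ; In<v = λ { {suc x} i → s≤s (In<v i) } }
  where
  open DeadInterval D
  In′ : Fin (suc n) → Set
  In′ zero    = ⊥
  In′ (suc x) = In x
  in?′ : ∀ x → Dec (In′ x)
  in?′ zero    = no id
  in?′ (suc x) = in? x
  convex′ : ∀ {x y z} → x Fin.≤ y → y Fin.≤ z → In′ x → In′ z → In′ y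
  convex′ {suc x} {suc y} {suc z} (s≤s x≤y) (s≤s y≤z) = convex x≤y y≤z
  ¬R0 : ∀ {x} → In x → ¬ rel R zero (suc x)
  ¬R0 i r = u∉In (closedˡ (~trans R (~sym R r) (cv z≤n (s≤s (ℕ.<⇒≤ (u<In i))) r)) i)
  ¬S0 : ∀ {x} → In x → ¬ rel S zero (suc x)
  ¬S0 i r = u∉In (closedʳ (~trans S (~sym S r) (nc (s≤s z≤n) (s≤s (u<In i)) (s≤s (In<v i)) r arc)) i)
  closedˡ′ : ∀ {x y} → rel R x y → In′ x → In′ y
  closedˡ′ {suc x} {zero}  r i = ¬R0 i (~sym R r)
  closedˡ′ {suc x} {suc y} r i = closedˡ r i
  closedʳ′ : ∀ {x y} → rel S x y → In′ x → In′ y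
  closedʳ′ {suc x} {zero}  r i = ¬S0 i (~sym S r)
  closedʳ′ {suc x} {suc y} r i = closedʳ r i

component-convex : (m : Models {n} st ms R S) → ∀ {i x y z} → x Fin.≤ y → y Fin.≤ z →
                   component m x ≡ i → component m z ≡ i → component m y ≡ i
component-convex m {i} {x} {y} {z} x≤y y≤z cx cz = ℕ.≤-antisym
  (subst (component m y ℕ.≤_) cz (component-monotone m y≤z))
  (subst (ℕ._≤ component m y) cx (component-monotone m x≤y))

component-interval : Convex R → (m : Models {n} st ms R S) → ∀ {i} → i ℕ.< length st → ClosedInterval R S
component-interval {R = R} {S = S} cv m {i} i< = record
  { In = λ x → component m x ≡ i ; in? = λ x → component m x ℕ.≟ i ; convex = component-convex m
  ; closedˡ = λ r cx → trans (sym (component-rel R cv m r)) cx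
  ; closedʳ = λ r cx → trans (sym (component-link S m r)) cx
  ; member = component-onto m i< }

-- Components are ordered from left to right, so all of component `i` lies under the arc from `zero`
-- to `v`. The arc does not touch it, and the last hypothesis excludes an `R`-link from `zero`.
dead-component : (R S : DecEquiv (suc n)) → Convex R → (m : Models {n} st ms (tail R) (tail S)) →
  ∀ {i v} → i ℕ.< component m v → rel S zero (suc v) → (∀ {x} → component m x ≡ i → ¬ rel R zero (suc x)) →
  DeadInterval R S
dead-component {n} R S cv m {i} {v} i<v 0v ¬0R = record
  { interval = record
    { In = In′ ; in? = in?′ ; convex = convex′ ; closedˡ = closedˡ′ ; closedʳ = closedʳ′
    ; member = let (x , eq) = component-onto m (ℕ.<-trans i<v (component-< m v)) in suc x , eq }
  ; u = zero ; v = suc v ; arc = 0v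
  ; u<In = λ { {suc x} _ → s≤s z≤n }
  ; In<v = λ { {suc x} refl → s≤s (ℕ.≰⇒> λ v≤x → ℕ.<⇒≱ i<v (component-monotone m v≤x)) } }
  where
  open ClosedInterval (component-interval (tail-convex R cv) m (ℕ.<-trans i<v (component-< m v)))
  In′ : Fin (suc n) → Set
  In′ zero    = ⊥
  In′ (suc x) = component m x ≡ i
  in?′ : ∀ x → Dec (In′ x)
  in?′ zero    = no id
  in?′ (suc x) = component m x ℕ.≟ i
  convex′ : ∀ {x y z} → x Fin.≤ y → y Fin.≤ z → In′ x → In′ z → In′ y
  convex′ {suc x} {suc y} {suc z} (s≤s x≤y) (s≤s y≤z) = component-convex m x≤y y≤z
  closedˡ′ : ∀ {x y} → rel R x y → In′ x → In′ y
  closedˡ′ {suc x} {zero}  r i = ¬0R i (~sym R r)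
  closedˡ′ {suc x} {suc y} r i = closedˡ r i
  closedʳ′ : ∀ {x y} → rel S x y → In′ x → In′ y
  closedʳ′ {suc x} {zero}  r eq = ℕ.<-irrefl (trans (sym eq) (component-link (tail S) m (~trans S r 0v))) i<v
  closedʳ′ {suc x} {suc y} r i = closedʳ r i

locate : ∀ g k → (∃[ h ] g ≡ k + h) ⊎ (∃[ i ] k ≡ suc g + i)
locate g       zero    = inj₁ (g , refl)
locate zero    (suc k) = inj₂ (k , refl)
locate (suc g) (suc k) with locate g k
... | inj₁ (h , refl) = inj₁ (h , refl)
... | inj₂ (i , refl) = inj₂ (i , refl)

-- By noncrossing, `zero` can only join a visible class. If that class lies beyond component 0, the
-- arc kills component 0 unless `zero` has an `R`-link into it; with such a link, a class beyond
-- component 1 kills component 1.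
parse : ∀ {n} (R S : DecEquiv n) → Convex R → NonCrossing S →
        DeadInterval R S ⊎ (∃₂ λ st ms → Models st ms R S)
parse {zero}  R S cv nc = inj₂ ([] , [] , empty)
parse {suc n} R S cv nc with parse (tail R) (tail S) (tail-convex R cv) (tail-nonCrossing S nc)
... | inj₁ D = inj₁ (dead-suc R S cv nc D)
... | inj₂ (st , ms , m) with linked? R | linked? S
...   | no ¬r | no ¬s = inj₂ (_ , _ , new-new ¬r ¬s m)
parse {suc n} R S cv nc | inj₂ ([]     , _ , empty) | yes (() , _) | no ¬s
parse {suc n} R S cv nc | inj₂ (g ∷ gs , ms , m) | yes r | no ¬s = inj₂ (_ , _ , cont-new r ¬s m)
parse {suc n} R S cv nc | inj₂ (st , ms , m) | r? | yes s with joins-visible S nc (models-links m) s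
parse {suc n} R S cv nc | inj₂ ([] , [] , empty) | r? | yes s | k , () , at , 0v
parse {suc n} R S cv nc | inj₂ (g ∷ gs , ms , m) | no ¬r | yes s | k , v , at , 0v with locate g k
... | inj₁ (h , refl) = inj₂ (_ , _ , new-join ¬r at 0v m)
... | inj₂ (i , refl) = inj₁ (dead-component R S cv m
        (subst (0 ℕ.<_) (sym (trans (component-visible m at) (index-beyond g gs i))) (s≤s z≤n))
        0v (λ {x} _ r → ¬r (x , r)))
parse {suc n} R S cv nc | inj₂ (g ∷ gs , ms , m) | yes r | yes s | k , v , at , 0v with locate g k
... | inj₁ (h , refl) = inj₂ (_ , _ , cont-cycle r at 0v m)
parse {suc n} R S cv nc | inj₂ (g ∷ [] , ms , m) | yes r | yes s | k , v , at , 0v | inj₂ (i , refl) =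
  contradiction (ℕ.<-≤-trans (At-< at) (ℕ.≤-reflexive (trans (models-size m) (ℕ.+-identityʳ (suc g)))))
    (ℕ.≤⇒≯ (ℕ.m≤m+n (suc g) i))
parse {suc n} R S cv nc | inj₂ (g ∷ g′ ∷ gs , ms , m) | yes r | yes s | k , v , at , 0v | inj₂ (i , refl) with locate g′ i
... | inj₁ (h , refl) = inj₂ (_ , _ , cont-join r at 0v m)
... | inj₂ (i′ , refl) = inj₁ (dead-component R S cv m {1}
        (subst (1 ℕ.<_) (sym (trans (component-visible m at)
          (trans (index-beyond g (g′ ∷ gs) _) (cong suc (index-beyond g′ gs i′))))) (s≤s (s≤s z≤n)))
        0v (λ eq r → contradiction (trans (sym eq) (component-next R cv m r)) λ ()))

-- Euler's relation, and uniqueness of the moves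

cycles : Vec Move n → ℕ
cycles []             = 0
cycles (leaf ∷ ms)     = cycles ms
cycles (node _ _ ∷ ms) = cycles ms
cycles (cyc _ ∷ ms)    = suc (cycles ms)

nodes : Vec Move n → ℕ
nodes []             = 0
nodes (leaf ∷ ms)     = nodes ms
nodes (node _ _ ∷ ms) = suc (nodes ms)
nodes (cyc _ ∷ ms)    = nodes ms

-- This ties the exponent of s to the number of blocks: with one component at the end, `# R` exceeds
-- the number of nodes by one.
models-#ˡ : (m : Models {n} st ms R S) → # R ≡ nodes ms + length st
models-#ˡ empty = refl
models-#ˡ {R = R} (new-new {ms = ms} ¬r _ m) = trans (#-isolated R ¬r) (trans (cong suc (models-#ˡ m)) (sym (ℕ.+-suc (nodes ms) _)))
models-#ˡ {R = R} (cont-new r _ m) = trans (#-linked R r) (models-#ˡ m)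
models-#ˡ {R = R} (new-join ¬r _ _ m) = trans (#-isolated R ¬r) (cong suc (models-#ˡ m))
models-#ˡ {R = R} (cont-join {ms = ms} r _ _ m) = trans (#-linked R r) (trans (models-#ˡ m) (ℕ.+-suc (nodes ms) _))
models-#ˡ {R = R} (cont-cycle r _ _ m) = trans (#-linked R r) (models-#ˡ m)

-- Euler's relation for the block graph, which has `# R + # S` vertices, `n` edges and `length st`
-- components; `cycles ms` is its cycle rank.
models-# : (m : Models {n} st ms R S) → # R + # S + cycles ms ≡ n + length st
models-# empty = refl
models-# {suc n} {R = R} {S} (new-new {gs = gs} {ms = ms} ¬r ¬s m) rewrite #-isolated R ¬r | #-isolated S ¬s =
  trans (solve 3 (λ p q c → con 1 :+ p :+ (con 1 :+ q) :+ c := con 2 :+ (p :+ q :+ c)) refl (# tail R) (# tail S) (cycles ms))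
  (trans (cong (2 +_) (models-# m)) (cong suc (sym (ℕ.+-suc n (length gs)))))
models-# {suc n} {R = R} {S} (cont-new {ms = ms} r ¬s m) rewrite #-linked R r | #-isolated S ¬s =
  trans (cong (_+ cycles ms) (ℕ.+-suc (# tail R) (# tail S))) (cong suc (models-# m))
models-# {R = R} {S} (new-join {v = v} ¬r _ 0v m) rewrite #-isolated R ¬r | #-linked S (v , 0v) = cong suc (models-# m)
models-# {suc n} {R = R} {S} (cont-join {gs = gs} {v = v} r _ 0v m) rewrite #-linked R r | #-linked S (v , 0v) =
  trans (models-# m) (ℕ.+-suc n (suc (length gs)))
models-# {R = R} {S} (cont-cycle {v = v} {ms = ms} r _ 0v m) rewrite #-linked R r | #-linked S (v , 0v) =
  trans (ℕ.+-suc _ (cycles ms)) (cong suc (models-# m))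

⊑-suc : (R R′ : DecEquiv (suc n)) → tail R ⊑ tail R′ → (∀ {y} → rel R zero (suc y) → rel R′ zero (suc y)) → R ⊑ R′
⊑-suc R R′ t z {zero}  {zero}  r = ~refl R′
⊑-suc R R′ t z {zero}  {suc y} r = z r
⊑-suc R R′ t z {suc x} {zero}  r = ~sym R′ (z (~sym R r))
⊑-suc R R′ t z {suc x} {suc y} r = t r

convex-extend : (R R′ : DecEquiv (suc n)) → Convex R → Convex R′ → tail R ⊑ tail R′ → Linked R′ →
                ∀ {y} → rel R zero (suc y) → rel R′ zero (suc y)
convex-extend {suc n} R R′ cv cv′ t (z , r′) r = ~trans R′ (cv′ {b = suc zero} z≤n (s≤s z≤n) r′) (t (convex-next R cv r))

-- A `leaf` alone does not tell `new-new` from `cont-new`, but the head of the resulting state does.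
-- This is why the moves are accompanied by their final state.
models-uniqueˡ : Convex R → Convex R′ → Models {n} st ms R S → Models st ms R′ S′ → R ⊑ R′
models-uniqueˡ cv cv′ empty empty {()}
models-uniqueˡ {R = R} {R′} cv cv′ (new-new ¬r _ m) (new-new ¬r′ _ m′) =
  ⊑-suc R R′ (models-uniqueˡ (tail-convex R cv) (tail-convex R′ cv′) m m′) (λ r → contradiction (_ , r) ¬r)
models-uniqueˡ {R = R} {R′} cv cv′ (cont-new r _ m) (cont-new r′ _ m′) = ⊑-suc R R′ t (convex-extend R R′ cv cv′ t r′)
  where
  t : tail R ⊑ tail R′
  t = models-uniqueˡ (tail-convex R cv) (tail-convex R′ cv′) m m′
models-uniqueˡ {R = R} {R′} cv cv′ (new-join ¬r _ _ m) (new-join ¬r′ _ _ m′) =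
  ⊑-suc R R′ (models-uniqueˡ (tail-convex R cv) (tail-convex R′ cv′) m m′) (λ r → contradiction (_ , r) ¬r)
models-uniqueˡ {R = R} {R′} cv cv′ (cont-join r _ _ m) (cont-join r′ _ _ m′) = ⊑-suc R R′ t (convex-extend R R′ cv cv′ t r′)
  where
  t : tail R ⊑ tail R′
  t = models-uniqueˡ (tail-convex R cv) (tail-convex R′ cv′) m m′
models-uniqueˡ {R = R} {R′} cv cv′ (cont-cycle r _ _ m) (cont-cycle r′ _ _ m′) = ⊑-suc R R′ t (convex-extend R R′ cv cv′ t r′)
  where
  t : tail R ⊑ tail R′
  t = models-uniqueˡ (tail-convex R cv) (tail-convex R′ cv′) m m′

links-unique : {ds : Vec (Maybe ℕ) n} (S S′ : DecEquiv n) → Links ds S → Links ds S′ → S ⊑ S′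
links-unique S S′ [] [] {()}
links-unique S S′ (isolated ¬s ls) (isolated ¬s′ ls′) =
  ⊑-suc S S′ (links-unique (tail S) (tail S′) ls ls′) (λ s → contradiction (_ , s) ¬s)
links-unique S S′ (joined at 0v ls) (joined at′ 0v′ ls′) with At-functional at at′
... | refl = ⊑-suc S S′ t (λ s → ~trans S′ 0v′ (t (~trans S (~sym S 0v) s)))
  where
  t : tail S ⊑ tail S′
  t = links-unique (tail S) (tail S′) ls ls′

-- The shadow of `Models` that remembers only the total number of visible classes. By `realise`, any
-- list of components with that total can be put back.
data Valid : ∀ {n} → ℕ → Vec Move n → Set where
  []   : Valid 0 []
  leaf : ∀ {n r} {ms : Vec Move n} → Valid r ms → Valid (suc r) (leaf ∷ ms)
  node : ∀ {n a e r} {ms : Vec Move n} → Valid (suc (a + e + r)) ms → Valid (suc r) (node a e ∷ ms)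

models-valid : cycles ms ≡ 0 → Models {n} st ms R S → Valid (size st) ms
models-valid c empty = []
models-valid c (new-new _ _ m) = leaf (models-valid c m)
models-valid c (cont-new _ _ m) = leaf (models-valid c m)
models-valid c (new-join {e = e} {h} {gs} {ms = ms} _ _ _ m) =
  node (subst (λ s → Valid s ms) (cong suc (ℕ.+-assoc e h (size gs))) (models-valid c m))
models-valid c (cont-join {a = a} {e} {h} {gs} {ms = ms} _ _ _ m) =
  node (subst (λ s → Valid s ms)
    (solve 4 (λ a e h s → con 1 :+ a :+ (con 1 :+ (e :+ h :+ s)) := con 1 :+ (con 1 :+ a :+ e :+ (h :+ s))) refl a e h (size gs))
    (models-valid c m))

valid-cycles : ∀ {r} → Valid {n} r ms → cycles ms ≡ 0
valid-cycles []       = refl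
valid-cycles (leaf v) = valid-cycles v
valid-cycles (node v) = valid-cycles v

link-position : {ds : Vec (Maybe ℕ) n} (S S′ : DecEquiv (suc n)) → S′ ⊑ S → Links ds (tail S) →
  ∀ {k k′ v v′} → At (visible ds) k v → At (visible ds) k′ v′ → rel S zero (suc v) → rel S′ zero (suc v′) → k ≡ k′
link-position S S′ S′⊑S ls at at′ 0v 0v′ = links-injective ls at at′ (~trans S (~sym S 0v) (S′⊑S 0v′))

-- The tails give equal states before the move. Visible points lie in distinct classes, so the
-- joined class determines its position; cancelling in position and state then identifies the
-- numbers of the move and the new state.
models-injective : cycles ms ≡ 0 → cycles ms′ ≡ 0 → Models {n} st ms R S → Models st′ ms′ R′ S′ →
  R ⊑ R′ → R′ ⊑ R → S ⊑ S′ → S′ ⊑ S → st ≡ st′ × ms ≡ ms′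
models-injective c c′ empty empty rr′ r′r ss′ s′s = refl , refl
models-injective c c′ (new-new _ _ m) (new-new _ _ m′) rr′ r′r ss′ s′s
  with models-injective c c′ m m′ rr′ r′r ss′ s′s
... | refl , refl = refl , refl
models-injective c c′ (new-new ¬r _ m) (cont-new (z , r) _ m′) rr′ r′r ss′ s′s = contradiction (z , r′r r) ¬r
models-injective c c′ (new-new _ ¬s m) (new-join _ _ s m′) rr′ r′r ss′ s′s = contradiction (_ , s′s s) ¬s
models-injective c c′ (new-new _ ¬s m) (cont-join _ _ s m′) rr′ r′r ss′ s′s = contradiction (_ , s′s s) ¬s
models-injective c c′ (cont-new (z , r) _ m) (new-new ¬r _ m′) rr′ r′r ss′ s′s = contradiction (z , rr′ r) ¬r
models-injective c c′ (cont-new _ _ m) (cont-new _ _ m′) rr′ r′r ss′ s′s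
  with models-injective c c′ m m′ rr′ r′r ss′ s′s
... | refl , refl = refl , refl
models-injective c c′ (cont-new _ ¬s m) (new-join _ _ s m′) rr′ r′r ss′ s′s = contradiction (_ , s′s s) ¬s
models-injective c c′ (cont-new _ ¬s m) (cont-join _ _ s m′) rr′ r′r ss′ s′s = contradiction (_ , s′s s) ¬s
models-injective c c′ (new-join _ _ s m) (new-new _ ¬s m′) rr′ r′r ss′ s′s = contradiction (_ , ss′ s) ¬s
models-injective c c′ (new-join _ _ s m) (cont-new _ ¬s m′) rr′ r′r ss′ s′s = contradiction (_ , ss′ s) ¬s
models-injective {S = S} {S′ = S′} c c′ (new-join {e = e} _ at 0v m) (new-join _ at′ 0v′ m′) rr′ r′r ss′ s′s
  with models-injective c c′ m m′ rr′ r′r ss′ s′s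
... | eq , refl with link-position S S′ s′s (models-links m) at at′ 0v 0v′
...   | refl with ℕ.+-cancelˡ-≡ e _ _ (∷-injectiveˡ eq) | ∷-injectiveʳ eq
...     | refl | refl = refl , refl
models-injective c c′ (new-join ¬r _ _ m) (cont-join (z , r) _ _ m′) rr′ r′r ss′ s′s = contradiction (z , r′r r) ¬r
models-injective c c′ (cont-join _ _ s m) (new-new _ ¬s m′) rr′ r′r ss′ s′s = contradiction (_ , ss′ s) ¬s
models-injective c c′ (cont-join _ _ s m) (cont-new _ ¬s m′) rr′ r′r ss′ s′s = contradiction (_ , ss′ s) ¬s
models-injective c c′ (cont-join (z , r) _ _ m) (new-join ¬r _ _ m′) rr′ r′r ss′ s′s = contradiction (z , rr′ r) ¬r
models-injective {S = S} {S′ = S′} c c′ (cont-join {a = a} {e} _ at 0v m) (cont-join _ at′ 0v′ m′) rr′ r′r ss′ s′s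
  with models-injective c c′ m m′ rr′ r′r ss′ s′s
... | eq , refl with ∷-injectiveˡ eq
...   | refl with ℕ.+-cancelˡ-≡ (suc a) _ _ (link-position S S′ s′s (models-links m) at at′ 0v 0v′)
...     | refl with ∷-injective (∷-injectiveʳ eq)
...       | eqh , refl with ℕ.+-cancelˡ-≡ e _ _ eqh
...         | refl = refl , refl

-- Realisation of valid move sequences

extend : DecEquiv n → Maybe (Fin n) → DecEquiv (suc n)
extend {n} R p = record
  { rel = rel′
  ; isDecEquivalence = record
    { isEquivalence = record { refl = λ {x} → refl′ x ; sym = λ {x} {y} → sym′ x y ; trans = λ {x} {y} {z} → trans′ x y z }
    ; _≟_ = dec′ } }
  where
  To : Maybe (Fin n) → Fin n → Set
  To nothing  x = ⊥
  To (just p) x = rel R p x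

  to? : ∀ p x → Dec (To p x)
  to? nothing  x = no id
  to? (just p) x = dec R p x

  to-rel : ∀ p {x y} → To p x → rel R x y → To p y
  to-rel (just p) = ~trans R

  to-to : ∀ p {x y} → To p x → To p y → rel R x y
  to-to (just p) px py = ~trans R (~sym R px) py

  rel′ : Fin (suc n) → Fin (suc n) → Set
  rel′ zero    zero    = ⊤
  rel′ zero    (suc y) = To p y
  rel′ (suc x) zero    = To p x
  rel′ (suc x) (suc y) = rel R x y

  refl′ : ∀ x → rel′ x x
  refl′ zero    = tt
  refl′ (suc x) = ~refl R

  sym′ : ∀ x y → rel′ x y → rel′ y x
  sym′ zero    zero    r = tt
  sym′ zero    (suc y) r = r
  sym′ (suc x) zero    r = r
  sym′ (suc x) (suc y) r = ~sym R r

  trans′ : ∀ x y z → rel′ x y → rel′ y z → rel′ x z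
  trans′ zero    y       zero    r s = tt
  trans′ zero    zero    (suc z) r s = s
  trans′ zero    (suc y) (suc z) r s = to-rel p r s
  trans′ (suc x) zero    zero    r s = r
  trans′ (suc x) zero    (suc z) r s = to-to p r s
  trans′ (suc x) (suc y) zero    r s = to-rel p s (~sym R r)
  trans′ (suc x) (suc y) (suc z) r s = ~trans R r s

  dec′ : ∀ x y → Dec (rel′ x y)
  dec′ zero    zero    = yes tt
  dec′ zero    (suc y) = to? p y
  dec′ (suc x) zero    = to? p x
  dec′ (suc x) (suc y) = dec R x y

extend-nothing : (R : DecEquiv n) → ¬ Linked (extend R nothing)
extend-nothing R (_ , ())

extend-nothing-convex : (R : DecEquiv n) → Convex R → Convex (extend R nothing)
extend-nothing-convex R cv {zero}  {zero}  _ _ r = tt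
extend-nothing-convex R cv {zero}  {suc b} {zero} _ () r
extend-nothing-convex R cv {zero}  {suc b} {suc c} _ _ ()
extend-nothing-convex R cv {suc a} {suc b} {suc c} (s≤s p) (s≤s q) r = cv p q r

extend-zero-convex : (R : DecEquiv (suc n)) → Convex R → Convex (extend R (just zero))
extend-zero-convex R cv {zero}  {zero}  _ _ r = tt
extend-zero-convex R cv {zero}  {suc b} {suc c} _ (s≤s q) r = cv z≤n q r
extend-zero-convex R cv {suc a} {suc b} {suc c} (s≤s p) (s≤s q) r = cv p q r

Realised : List ℕ → Vec Move n → Set₁
Realised {n} st ms = Σ (DecEquiv n) λ R → Σ (DecEquiv n) λ S → Convex R × Models st ms R S

-- The state after a move determines the state before it: for a `leaf` by whether its head is zero,
-- for a `node` by whether its first number is zero. The required total is then the one that `Valid`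
-- supplies.
realise : ∀ {r} st → size st ≡ r → Valid {n} r ms → Realised st ms
realise [] eq [] = coarse , coarse , (λ { {()} }) , empty
realise (zero ∷ gs) refl (leaf v) with realise gs refl v
... | R , S , cv , m = extend R nothing , extend S nothing , extend-nothing-convex R cv ,
      new-new (extend-nothing R) (extend-nothing S) m
realise (suc g ∷ gs) refl (leaf v) with realise (g ∷ gs) refl v
-- The tail has a component, hence a first point, which serves as the right neighbour to be
-- continued.
realise {suc (suc n)} (suc g ∷ gs) refl (leaf v) | R , S , cv , m = extend R (just zero) , extend S nothing , extend-zero-convex R cv ,
      cont-new (zero , ~refl R) (extend-nothing S) m
realise (h ∷ gs) refl (node {a = zero} {e} {ms = ms} v) with realise (e + h ∷ gs) (cong suc (ℕ.+-assoc e h (size gs))) v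
... | R , S , cv , m with At-total (visible (depths ms)) {e} (ℕ.<-≤-trans (s≤s (ℕ.≤-trans (ℕ.m≤m+n e h) (ℕ.m≤m+n (e + h) (size gs))))
                            (ℕ.≤-reflexive (sym (models-size m))))
...   | u , at = extend R nothing , extend S (just u) , extend-nothing-convex R cv ,
                 new-join (extend-nothing R) at (~refl S) m
realise (h ∷ gs) refl (node {a = suc a} {e} {ms = ms} v) with realise (a ∷ e + h ∷ gs)
    (solve 4 (λ a e h s → con 1 :+ a :+ (con 1 :+ (e :+ h :+ s)) := con 1 :+ (con 1 :+ a :+ e :+ (h :+ s))) refl a e h (size gs)) v
... | R , S , cv , m with At-total (visible (depths ms)) {suc a + e} (ℕ.<-≤-trans
          (ℕ.+-monoʳ-< (suc a) (s≤s (ℕ.≤-trans (ℕ.m≤m+n e h) (ℕ.m≤m+n (e + h) (size gs)))))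
          (ℕ.≤-reflexive (sym (models-size m))))
realise {suc (suc n)} (h ∷ gs) refl (node {a = suc a} {e} {ms = ms} v) | R , S , cv , m | u , at =
  extend R (just zero) , extend S (just u) , extend-zero-convex R cv ,
  cont-join (zero , ~refl R) at (~refl S) m

-- Counting

-- Let w = z (1 + s w (1 - w)⁻²).  W k r t j has as many elements as the
-- coefficient of zⁿ sʲ in wʳ (1 - w)⁻ᵏ, where n = r + t + j: leaf and node
-- expand a factor w, close and more expand a factor (1 - w)⁻¹ = 1 + w (1 - w)⁻¹.
data W : (k r t j : ℕ) → Set where
  nil   : W 0 0 0 0
  leaf  : ∀ {r t j} → W 0 r t j → W 0 (suc r) t j
  node  : ∀ {r t j} → W 2 (suc r) t j → W 0 (suc r) t (suc j)
  close : ∀ {k r t j} → W k r t j → W (suc k) r t j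
  more  : ∀ {k r t j} → W (suc k) (suc r) t j → W (suc k) r (suc t) j

count : (k r t j : ℕ) → ℕ
count 0       0       0       0       = 1
count 0       0       0       (suc j) = 0
count 0       0       (suc t) j       = 0
count 0       (suc r) t       0       = count 0 r t 0
count 0       (suc r) t       (suc j) = count 0 r t (suc j) + count 2 (suc r) t j
count (suc k) r       0       j       = count k r 0 j
count (suc k) r       (suc t) j       = count k r (suc t) j + count (suc k) (suc r) t j

W↔Fin : ∀ k r t j → W k r t j ↔ Fin (count k r t j)
W↔Fin 0 0 0 0 = mk↔ₛ′ (λ _ → zero) (λ _ → nil) (λ { zero → refl }) (λ { nil → refl })
W↔Fin 0 0 0 (suc j) = mk↔ₛ′ (λ ()) (λ ()) (λ ()) (λ ())
W↔Fin 0 0 (suc t) j = mk↔ₛ′ (λ ()) (λ ()) (λ ()) (λ ())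
W↔Fin 0 (suc r) t 0 = ↔-trans
  (mk↔ₛ′ (λ { (leaf w) → w }) leaf (λ _ → refl) (λ { (leaf w) → refl }))
  (W↔Fin 0 r t 0)
W↔Fin 0 (suc r) t (suc j) = ↔-trans
  (mk↔ₛ′ (λ { (leaf w) → inj₁ w ; (node w) → inj₂ w })
         (λ { (inj₁ w) → leaf w ; (inj₂ w) → node w })
         (λ { (inj₁ w) → refl ; (inj₂ w) → refl })
         (λ { (leaf w) → refl ; (node w) → refl }))
  (↔-trans (W↔Fin 0 r t (suc j) ⊎-↔ W↔Fin 2 (suc r) t j) (↔-sym Fin.+↔⊎))
W↔Fin (suc k) r 0 j = ↔-trans
  (mk↔ₛ′ (λ { (close w) → w }) close (λ _ → refl) (λ { (close w) → refl }))
  (W↔Fin k r 0 j)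
W↔Fin (suc k) r (suc t) j = ↔-trans
  (mk↔ₛ′ (λ { (close w) → inj₁ w ; (more w) → inj₂ w })
         (λ { (inj₁ w) → close w ; (inj₂ w) → more w })
         (λ { (inj₁ w) → refl ; (inj₂ w) → refl })
         (λ { (close w) → refl ; (more w) → refl }))
  (↔-trans (W↔Fin k r (suc t) j ⊎-↔ W↔Fin (suc k) (suc r) t j) (↔-sym Fin.+↔⊎))

-- multichoose b t is the coefficient of xᵗ in (1 - x)⁻ᵇ
multichoose : ℕ → ℕ → ℕ
multichoose b       0       = 1
multichoose 0       (suc t) = 0
multichoose (suc b) (suc t) = multichoose b (suc t) + multichoose (suc b) t

-- The coefficient of xᵗ in x (1 - x)⁻ᵇ. Truncated subtraction in the index would give 1 instead of
-- 0 at t = 0.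
multichoose⁻ : ℕ → ℕ → ℕ
multichoose⁻ b zero    = 0
multichoose⁻ b (suc t) = multichoose b t

multichoose-suc : ∀ b t → multichoose (suc b) t ≡ multichoose b t + multichoose⁻ (suc b) t
multichoose-suc b zero = refl
multichoose-suc b (suc t) = refl

module _ where
  open ≡-Reasoning

  multichoose-C : ∀ b t → multichoose (suc b) t ≡ (b + t) C t
  multichoose-C b zero = refl
  multichoose-C zero (suc t) = begin
    multichoose 1 t ≡⟨ multichoose-C 0 t ⟩
    t C t           ≡⟨ nCn≡1 t ⟩
    1               ≡⟨ nCn≡1 (suc t) ⟨
    suc t C suc t   ∎
  multichoose-C (suc b) (suc t) = begin
    multichoose (suc b) (suc t) + multichoose (suc (suc b)) t
      ≡⟨ cong₂ _+_ (multichoose-C b (suc t)) (multichoose-C (suc b) t) ⟩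
    (b + suc t) C suc t + suc (b + t) C t
      ≡⟨ cong (λ x → x C suc t + suc (b + t) C t) (ℕ.+-suc b t) ⟩
    suc (b + t) C suc t + suc (b + t) C t
      ≡⟨ ℕ.+-comm (suc (b + t) C suc t) _ ⟩
    suc (b + t) C t + suc (b + t) C suc t
      ≡⟨ nCk+nC[k+1]≡[n+1]C[k+1] (suc (b + t)) t ⟩
    suc (suc (b + t)) C suc t
      ≡⟨ cong (λ x → suc x C suc t) (ℕ.+-suc b t) ⟨
    suc (b + suc t) C suc t ∎

  -- Coefficients of xᵗ in x d/dx (1 - x)⁻ᵇ = b x (1 - x)⁻ᵇ⁻¹.
  multichoose-absorb : ∀ b t → t * multichoose b t ≡ b * multichoose⁻ (suc b) t
  multichoose-absorb b zero = sym (ℕ.*-zeroʳ b)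
  multichoose-absorb zero (suc t) = ℕ.*-zeroʳ (suc t)
  multichoose-absorb (suc b) (suc t) = begin
    suc t * (x + y)     ≡⟨ solve 3 (λ t x y → (con 1 :+ t) :* (x :+ y) := (con 1 :+ t) :* x :+ (y :+ t :* y)) refl t x y ⟩
    suc t * x + (y + t * y)
      ≡⟨ cong₂ (λ u v → u + (y + v)) (multichoose-absorb b (suc t)) (multichoose-absorb (suc b) t) ⟩
    b * y + (y + suc b * z) ≡⟨ solve 3 (λ b y z → b :* y :+ (y :+ (con 1 :+ b) :* z) := (con 1 :+ b) :* (y :+ z)) refl b y z ⟩
    suc b * (y + z)     ≡⟨ cong (suc b *_) (multichoose-suc (suc b) t) ⟨
    suc b * multichoose (suc (suc b)) t ∎
    where
    x = multichoose b (suc t)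
    y = multichoose (suc b) t
    z = multichoose⁻ (suc (suc b)) t

  C-pascal : ∀ n k → suc n C suc k ≡ n C k + n C suc k
  C-pascal n k = sym (nCk+nC[k+1]≡[n+1]C[k+1] n k)

  C-absorb : ∀ n k → suc k * (suc n C suc k) ≡ suc n * (n C k)
  C-absorb n zero = trans (ℕ.+-identityʳ _) (trans (nC1≡n (suc n)) (sym (ℕ.*-identityʳ _)))
  C-absorb zero (suc k) = trans (cong (suc (suc k) *_) (k>n⇒nCk≡0 {1} {suc (suc k)} (ℕ.s≤s (ℕ.s≤s ℕ.z≤n)))) (ℕ.*-zeroʳ (suc (suc k)))
  C-absorb (suc n) (suc k) = begin
    (2 + k) * (suc (suc n) C suc (suc k)) ≡⟨ cong ((2 + k) *_) (C-pascal (suc n) (suc k)) ⟩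
    (2 + k) * (x + y)  ≡⟨ solve 3 (λ k x y → (con 2 :+ k) :* (x :+ y) := x :+ (con 1 :+ k) :* x :+ (con 2 :+ k) :* y) refl k x y ⟩
    x + suc k * x + (2 + k) * y ≡⟨ cong₂ (λ u v → x + u + v) (C-absorb n k) (C-absorb n (suc k)) ⟩
    x + suc n * (n C k) + suc n * (n C suc k) ≡⟨ solve 4 (λ x n u v → x :+ (con 1 :+ n) :* u :+ (con 1 :+ n) :* v := x :+ (con 1 :+ n) :* (u :+ v)) refl x n (n C k) (n C suc k) ⟩
    x + suc n * (n C k + n C suc k) ≡⟨ cong (λ u → x + suc n * u) (C-pascal n k) ⟨
    x + suc n * x ∎
    where
    x = suc n C suc k
    y = suc n C suc (suc k)

  -- (n - k) C(n, k) = n C(n - 1, k) with n = 1 + k + m.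
  C-absorb′ : ∀ m k → suc m * (suc (m + k) C k) ≡ suc (m + k) * ((m + k) C k)
  C-absorb′ m k = ℕ.+-cancelˡ-≡ (k * (suc (m + k) C k)) _ _ (trans (lemma k) (sym (rhs k)))
    where
    lemma : ∀ k → k * (suc (m + k) C k) + suc m * (suc (m + k) C k) ≡ suc (m + k) * (suc (m + k) C k)
    lemma k = solve 3 (λ k m c → k :* c :+ (con 1 :+ m) :* c := (con 1 :+ (m :+ k)) :* c) refl k m (suc (m + k) C k)
    rhs : ∀ k → k * (suc (m + k) C k) + suc (m + k) * ((m + k) C k) ≡ suc (m + k) * (suc (m + k) C k)
    rhs zero = refl
    rhs (suc k) = begin
      suc k * (suc N C suc k) + suc N * (N C suc k) ≡⟨ cong (_+ suc N * (N C suc k)) (C-absorb N k) ⟩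
      suc N * (N C k) + suc N * (N C suc k)         ≡⟨ ℕ.*-distribˡ-+ (suc N) (N C k) (N C suc k) ⟨
      suc N * (N C k + N C suc k)                   ≡⟨ cong (suc N *_) (C-pascal N k) ⟨
      suc N * (suc N C suc k) ∎
      where N = m + suc k

  -- Lagrange inversion asks for the coefficient of uⁿ⁻¹ sʲ in H′(u) (1 + s u (1 - u)⁻²)ⁿ, where H =
  -- uʳ (1 - u)⁻ᵏ. This is C(n, j) times the coefficient of uʳ⁺ᵗ⁻¹ in H′(u) (1 - u)⁻²ʲ, and the two
  -- summands come from the product rule for H′.
  weight : (k r t j : ℕ) → ℕ
  weight k r t j = r * multichoose (2 * j + k) t + k * multichoose⁻ (suc (2 * j + k)) t

  -- The weight is linear in H, and uʳ (1 - u)⁻ᵏ⁻¹ = uʳ (1 - u)⁻ᵏ + uʳ⁺¹ (1 - u)⁻ᵏ⁻¹.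
  weight-suc : ∀ k r t j → weight (suc k) r (suc t) j ≡ weight k r (suc t) j + weight (suc k) (suc r) t j
  weight-suc k r t j rewrite ℕ.+-suc (2 * j) k | multichoose-suc (suc (2 * j + k)) t =
    solve 5 (λ k r x y z → r :* (x :+ y) :+ (con 1 :+ k) :* (y :+ z) :=
                           (r :* x :+ k :* y) :+ ((con 1 :+ r) :* y :+ (con 1 :+ k) :* z))
      refl k r (multichoose (2 * j + k) (suc t)) (multichoose (suc (2 * j + k)) t)
      (multichoose⁻ (suc (suc (2 * j + k))) t)

  -- The arithmetic behind wʳ⁺¹ = z (wʳ + s wʳ⁺¹ (1 - w)⁻²). With N = r + t + j, the counts `x` and
  -- `y` of the two summands are known up to the factor N, and `c₁` = C(N, j) and `c₂` = C(N, j - 1)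
  -- are expressed through `c` = C(N + 1, j).
  cancel-step : ∀ r t j x y c c₁ c₂ h h′ → .{{NonZero (r + t + j)}} →
    (r + t + j) * x ≡ c₁ * (r * h) →
    (r + t + j) * y ≡ c₂ * (suc r * h + 2 * h′) →
    suc (r + t + j) * c₁ ≡ suc (r + t) * c →
    suc (r + t + j) * c₂ ≡ j * c →
    t * h ≡ 2 * j * h′ →
    suc (r + t + j) * (x + y) ≡ c * (suc r * h)
  cancel-step r t j x y c c₁ c₂ h h′ eqx eqy eqc₁ eqc₂ eqh = ℕ.*-cancelˡ-≡ _ _ N (begin
    N * (suc N * (x + y))
      ≡⟨ solve 3 (λ N x y → N :* ((con 1 :+ N) :* (x :+ y)) := (con 1 :+ N) :* (N :* x) :+ (con 1 :+ N) :* (N :* y)) refl N x y ⟩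
    suc N * (N * x) + suc N * (N * y)
      ≡⟨ cong₂ (λ u v → suc N * u + suc N * v) eqx eqy ⟩
    suc N * (c₁ * (r * h)) + suc N * (c₂ * (suc r * h + 2 * h′))
      ≡⟨ cong₂ _+_ (ℕ.*-assoc (suc N) c₁ _) (ℕ.*-assoc (suc N) c₂ _) ⟨
    suc N * c₁ * (r * h) + suc N * c₂ * (suc r * h + 2 * h′)
      ≡⟨ cong₂ (λ u v → u * (r * h) + v * (suc r * h + 2 * h′)) eqc₁ eqc₂ ⟩
    suc (r + t) * c * (r * h) + j * c * (suc r * h + 2 * h′)
      ≡⟨ solve 6 (λ r t j c h h′ → (con 1 :+ (r :+ t)) :* c :* (r :* h) :+ j :* c :* ((con 1 :+ r) :* h :+ con 2 :* h′)
                   := ((con 1 :+ (r :+ t)) :* r :+ j :* (con 1 :+ r)) :* c :* h :+ c :* (con 2 :* j :* h′)) refl r t j c h h′ ⟩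
    (suc (r + t) * r + j * suc r) * c * h + c * (2 * j * h′)
      ≡⟨ cong (λ u → (suc (r + t) * r + j * suc r) * c * h + c * u) eqh ⟨
    (suc (r + t) * r + j * suc r) * c * h + c * (t * h)
      ≡⟨ solve 5 (λ r t j c h → ((con 1 :+ (r :+ t)) :* r :+ j :* (con 1 :+ r)) :* c :* h :+ c :* (t :* h)
                   := (r :+ t :+ j) :* (c :* ((con 1 :+ r) :* h))) refl r t j c h ⟩
    N * (c * (suc r * h)) ∎)
    where N = r + t + j

  -- Lagrange inversion for wʳ (1 - w)⁻ᵏ, where w = z (1 + s w (1 - w)⁻²), in
  -- the form n · count = C(n, j) · weight with n = r + t + j.
  count-formula : ∀ k r t j → (r + t + j) * count k r t j ≡ ((r + t + j) C j) * weight k r t j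
  count-formula₀ : ∀ r t j → .{{NonZero (r + t + j)}} →
    suc (r + t + j) * count 0 (suc r) t j ≡ (suc (r + t + j) C j) * (suc r * multichoose (2 * j) t)

  count-formula₀ r t 0 = begin
    suc N * count 0 r t 0 ≡⟨ cong (suc N *_) (ℕ.+-identityʳ _) ⟨
    suc N * (count 0 r t 0 + 0)
      -- There is no `node` at j = 0, so the second summand and its binomial are both 0.
      ≡⟨ cancel-step r t 0 (count 0 r t 0) 0 1 1 0 (multichoose 0 t) (multichoose⁻ 1 t)
           (trans (count-formula 0 r t 0) (cong (1 *_) (ℕ.+-identityʳ _)))
           (ℕ.*-zeroʳ N)
           (cong (_* 1) (cong suc (ℕ.+-identityʳ (r + t))))
           (ℕ.*-zeroʳ (suc N))
           (multichoose-absorb 0 t) ⟩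
    1 * (suc r * multichoose 0 t) ∎
    where N = r + t + 0
  count-formula₀ r t (suc j) =
    cancel-step r t (suc j) (count 0 r t (suc j)) (count 2 (suc r) t j) (suc N C suc j) (N C suc j) (N C j) h h′
      (trans (count-formula 0 r t (suc j))
         (cong (λ b → (N C suc j) * (r * multichoose b t + 0)) (ℕ.+-identityʳ (2 * suc j)) ⟨trans⟩
          cong ((N C suc j) *_) (ℕ.+-identityʳ _)))
      (subst (λ n → n * count 2 (suc r) t j ≡ (n C j) * (suc r * h + 2 * h′)) (sym (ℕ.+-suc (r + t) j))
        (trans (count-formula 2 (suc r) t j)
          (cong (λ b → (suc (r + t + j) C j) * (suc r * multichoose b t + 2 * multichoose⁻ (suc b) t))
            (solve 1 (λ j → con 2 :* j :+ con 2 := con 2 :* (con 1 :+ j)) refl j))))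
      (sym (C-absorb′ (r + t) (suc j)))
      (sym (C-absorb N j))
      (multichoose-absorb (2 * suc j) t)
    where
    N = r + t + suc j
    h = multichoose (2 * suc j) t
    h′ = multichoose⁻ (suc (2 * suc j)) t
    _⟨trans⟩_ = trans

  unweight : ∀ r t j {x} → x ≡ ((r + t + j) C j) * (r * multichoose (2 * j) t) → x ≡ ((r + t + j) C j) * weight 0 r t j
  unweight r t j eq = trans eq (cong (((r + t + j) C j) *_)
    (trans (cong (λ b → r * multichoose b t) (sym (ℕ.+-identityʳ (2 * j)))) (sym (ℕ.+-identityʳ _))))

  count-formula 0 0 0 0 = refl
  count-formula 0 0 0 (suc j) = trans (ℕ.*-zeroʳ (suc j)) (sym (ℕ.*-zeroʳ (suc j C suc j)))
  count-formula 0 0 (suc t) j = trans (ℕ.*-zeroʳ (suc t + j)) (sym (ℕ.*-zeroʳ ((suc t + j) C j)))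
  -- The recurrence would refer to n = 0, where a formula multiplied by n carries no information.
  count-formula 0 1 0 0 = refl
  count-formula 0 (suc (suc r)) t j = unweight (suc (suc r)) t j (count-formula₀ (suc r) t j)
  count-formula 0 1 (suc t) j = unweight 1 (suc t) j (count-formula₀ 0 (suc t) j)
  count-formula 0 1 0 (suc j) = unweight 1 0 (suc j) (count-formula₀ 0 0 (suc j))
  count-formula (suc k) r 0 j = begin
    (r + 0 + j) * count k r 0 j ≡⟨ count-formula k r 0 j ⟩
    ((r + 0 + j) C j) * weight k r 0 j
      ≡⟨ cong (λ x → ((r + 0 + j) C j) * (r * 1 + x)) (trans (ℕ.*-zeroʳ k) (sym (ℕ.*-zeroʳ k))) ⟩
    ((r + 0 + j) C j) * weight (suc k) r 0 j ∎
  count-formula (suc k) r (suc t) j = begin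
    N * (count k r (suc t) j + count (suc k) (suc r) t j) ≡⟨ ℕ.*-distribˡ-+ N (count k r (suc t) j) _ ⟩
    N * count k r (suc t) j + N * count (suc k) (suc r) t j
      ≡⟨ cong₂ _+_ (count-formula k r (suc t) j)
           (subst (λ N → N * count (suc k) (suc r) t j ≡ (N C j) * weight (suc k) (suc r) t j)
             (cong (_+ j) (sym (ℕ.+-suc r t))) (count-formula (suc k) (suc r) t j)) ⟩
    (N C j) * weight k r (suc t) j + (N C j) * weight (suc k) (suc r) t j
      ≡⟨ ℕ.*-distribˡ-+ (N C j) _ _ ⟨
    (N C j) * (weight k r (suc t) j + weight (suc k) (suc r) t j)
      ≡⟨ cong ((N C j) *_) (weight-suc k r t j) ⟨
    (N C j) * weight (suc k) r (suc t) j ∎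
    where N = r + suc t + j

-- From the distance to trees and back

module _ {R S : DecEquiv n} (I : ClosedInterval R S) where
  open ClosedInterval I

  sides : DecEquiv n
  sides = record
    { rel = λ x y → does (in? x) ≡ does (in? y)
    ; isDecEquivalence = On.isDecEquivalence (λ x → does (in? x)) (≡.isDecEquivalence Bool._≟_) }

  same-side⁺ : ∀ {x y} → (In x → In y) → (In y → In x) → rel sides x y
  same-side⁺ {x} {y} f g with in? x | in? y
  ... | yes _ | yes _ = refl
  ... | no _  | no _  = refl
  ... | yes p | no ¬q = contradiction (f p) ¬q
  ... | no ¬p | yes q = contradiction (g q) ¬p

  same-side⁻ : ∀ {x y} → rel sides x y → In x → In y
  same-side⁻ {x} {y} r p with in? x | in? y
  ... | _     | yes q = q
  ... | no ¬p | no _  = contradiction p ¬p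
  same-side⁻ {x} {y} () p | yes _ | no _

  sides-nonCrossing : NonCrossing sides
  sides-nonCrossing {a} {b} {c} {d} a<b b<c c<d ac bd = same-side⁺
    (λ a∈ → convex (ℕ.<⇒≤ a<b) (ℕ.<⇒≤ b<c) a∈ (same-side⁻ {a} {c} ac a∈))
    (λ b∈ → same-side⁻ {c} {a} (sym ac) (convex (ℕ.<⇒≤ b<c) (ℕ.<⇒≤ c<d) b∈ (same-side⁻ {b} {d} bd b∈)))

  ⊑-sidesˡ : R ⊑ sides
  ⊑-sidesˡ r = same-side⁺ (closedˡ r) (closedˡ (~sym R r))

  ⊑-sidesʳ : S ⊑ sides
  ⊑-sidesʳ r = same-side⁺ (closedʳ r) (closedʳ (~sym S r))

closed-interval-full : (π ρ : NC (suc n)) → HasHasseDistance π ρ n →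
  (I : ClosedInterval (equiv π) (equiv ρ)) → ∀ y → ClosedInterval.In I y
closed-interval-full π ρ dist I y = same-side⁻ I {proj₁ member}
  (distance⇒connected π ρ dist (sides I) (sides-nonCrossing I) (⊑-sidesˡ I) (⊑-sidesʳ I) _ y) (proj₂ member)
  where open ClosedInterval I

-- A dead interval and a second component would each give a proper closed interval. With one
-- component left, Euler's relation and the known value of |π| + |ρ| leave no room for a cycle.
distance⇒models : (π ρ : NC (suc n)) → IsInterval π → HasHasseDistance π ρ n →
  ∃₂ λ g ms → Models (g ∷ []) ms (equiv π) (equiv ρ) × cycles ms ≡ 0
distance⇒models {n} π ρ int dist with parse (equiv π) (equiv ρ) (equiv-convex π int) (equiv-nonCrossing ρ)
... | inj₁ D = contradiction (closed-interval-full π ρ dist interval u) u∉In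
  where open DeadInterval D
... | inj₂ (g ∷ [] , ms , m) = g , ms , m , ℕ.+-cancelˡ-≡ (# equiv π + # equiv ρ) _ _
      (trans (models-# m) (trans (ℕ.+-comm (suc n) 1) (trans (sym (distance⇒# π ρ dist)) (sym (ℕ.+-identityʳ _)))))
... | inj₂ (g ∷ g′ ∷ gs , ms , m) = contradiction
      (trans (sym (proj₂ x)) (closed-interval-full π ρ dist (component-interval (equiv-convex π int) m (s≤s z≤n)) (proj₁ x)))
      λ ()
  where
  x : ∃[ x ] component m x ≡ 1
  x = component-onto m (s≤s (s≤s z≤n))

models-resp : R ⊑ R′ → R′ ⊑ R → S ⊑ S′ → S′ ⊑ S → Models {n} st ms R S → Models st ms R′ S′
models-resp rr′ r′r ss′ s′s empty = empty
models-resp rr′ r′r ss′ s′s (new-new ¬r ¬s m) =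
  new-new (λ (y , r) → ¬r (y , r′r r)) (λ (y , s) → ¬s (y , s′s s)) (models-resp rr′ r′r ss′ s′s m)
models-resp rr′ r′r ss′ s′s (cont-new (y , r) ¬s m) =
  cont-new (y , rr′ r) (λ (y , s) → ¬s (y , s′s s)) (models-resp rr′ r′r ss′ s′s m)
models-resp rr′ r′r ss′ s′s (new-join ¬r at 0v m) =
  new-join (λ (y , r) → ¬r (y , r′r r)) at (ss′ 0v) (models-resp rr′ r′r ss′ s′s m)
models-resp rr′ r′r ss′ s′s (cont-join (y , r) at 0v m) = cont-join (y , rr′ r) at (ss′ 0v) (models-resp rr′ r′r ss′ s′s m)
models-resp rr′ r′r ss′ s′s (cont-cycle (y , r) at 0v m) = cont-cycle (y , rr′ r) at (ss′ 0v) (models-resp rr′ r′r ss′ s′s m)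

models⇒distance : (π ρ : NC (suc n)) → Convex (equiv π) → ∀ {g ms} → Models (g ∷ []) ms (equiv π) (equiv ρ) →
  cycles ms ≡ 0 → HasHasseDistance π ρ n
models⇒distance {n} π ρ cv {ms = ms} m c = connected⇒distance π ρ
  (trans (sym (ℕ.+-identityʳ _)) (trans (cong (# equiv π + # equiv ρ +_) (sym c)) (trans (models-# m) (ℕ.+-comm (suc n) 1))))
  (λ J π⊑J ρ⊑J x y → component-connected (equiv π) cv m J π⊑J ρ⊑J (trans (only x) (sym (only y))))
  where
  only : ∀ x → component m x ≡ 0
  only x = ℕ.n<1⇒n≡0 (component-< m x)

-- Words and move sequences

-- The two geometric series opened by a node spell out its numbers a and e in
-- unary, and the one of a word in W 1 1 t j the size of the final component.
data Encodes₀ : ∀ {r t j n} → W 0 r t j → Vec Move n → Set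
data Encodes₁ : ∀ {r t j n} → W 1 r t j → ℕ → Vec Move n → Set
data Encodes₂ : ∀ {r t j n} → W 2 r t j → ℕ → ℕ → Vec Move n → Set

data Encodes₀ where
  nil  : Encodes₀ nil []
  leaf : ∀ {r t j n} {w : W 0 r t j} {ms : Vec Move n} → Encodes₀ w ms → Encodes₀ (leaf w) (leaf ∷ ms)
  node : ∀ {r t j n a e} {w : W 2 (suc r) t j} {ms : Vec Move n} → Encodes₂ w a e ms → Encodes₀ (node w) (node a e ∷ ms)

data Encodes₁ where
  close : ∀ {r t j n} {w : W 0 r t j} {ms : Vec Move n} → Encodes₀ w ms → Encodes₁ (close w) 0 ms
  more  : ∀ {r t j n e} {w : W 1 (suc r) t j} {ms : Vec Move n} → Encodes₁ w e ms → Encodes₁ (more w) (suc e) ms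

data Encodes₂ where
  close : ∀ {r t j n e} {w : W 1 r t j} {ms : Vec Move n} → Encodes₁ w e ms → Encodes₂ (close w) 0 e ms
  more  : ∀ {r t j n a e} {w : W 2 (suc r) t j} {ms : Vec Move n} → Encodes₂ w a e ms → Encodes₂ (more w) (suc a) e ms

encode₀ : ∀ {r t j} (w : W 0 r t j) → ∃₂ λ n (ms : Vec Move n) → Encodes₀ w ms
encode₁ : ∀ {r t j} (w : W 1 r t j) → ∃[ e ] ∃₂ λ n (ms : Vec Move n) → Encodes₁ w e ms
encode₂ : ∀ {r t j} (w : W 2 r t j) → ∃₂ λ a e → ∃₂ λ n (ms : Vec Move n) → Encodes₂ w a e ms
encode₀ nil       = _ , _ , nil
encode₀ (leaf w)  with encode₀ w
... | _ , _ , p = _ , _ , leaf p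
encode₀ (node w)  with encode₂ w
... | _ , _ , _ , _ , p = _ , _ , node p
encode₁ (close w) with encode₀ w
... | _ , _ , p = _ , _ , _ , close p
encode₁ (more w)  with encode₁ w
... | _ , _ , _ , p = _ , _ , _ , more p
encode₂ (close w) with encode₁ w
... | _ , _ , _ , p = _ , _ , _ , _ , close p
encode₂ (more w)  with encode₂ w
... | _ , _ , _ , _ , p = _ , _ , _ , _ , more p

encodes₀-injective : ∀ {r t j n} {w w′ : W 0 r t j} {ms : Vec Move n} → Encodes₀ w ms → Encodes₀ w′ ms → w ≡ w′
encodes₁-injective : ∀ {r t j n e} {w w′ : W 1 r t j} {ms : Vec Move n} → Encodes₁ w e ms → Encodes₁ w′ e ms → w ≡ w′
encodes₂-injective : ∀ {r t j n a e} {w w′ : W 2 r t j} {ms : Vec Move n} → Encodes₂ w a e ms → Encodes₂ w′ a e ms → w ≡ w′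
encodes₀-injective nil nil = refl
encodes₀-injective (leaf p) (leaf q) = cong leaf (encodes₀-injective p q)
encodes₀-injective (node p) (node q) = cong node (encodes₂-injective p q)
encodes₁-injective (close p) (close q) = cong close (encodes₀-injective p q)
encodes₁-injective (more p) (more q) = cong more (encodes₁-injective p q)
encodes₂-injective (close p) (close q) = cong close (encodes₁-injective p q)
encodes₂-injective (more p) (more q) = cong more (encodes₂-injective p q)

encodes₀-valid : ∀ {r t j n} {w : W 0 r t j} {ms : Vec Move n} → Encodes₀ w ms → Valid r ms
encodes₁-valid : ∀ {r t j n e} {w : W 1 r t j} {ms : Vec Move n} → Encodes₁ w e ms → Valid (e + r) ms
encodes₂-valid : ∀ {r t j n a e} {w : W 2 r t j} {ms : Vec Move n} → Encodes₂ w a e ms → Valid (a + e + r) ms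
encodes₀-valid nil = []
encodes₀-valid (leaf p) = leaf (encodes₀-valid p)
encodes₀-valid (node {r} {a = a} {e} {ms = ms} p) = node (subst (λ r → Valid r ms) (ℕ.+-suc (a + e) r) (encodes₂-valid p))
encodes₁-valid (close p) = encodes₀-valid p
encodes₁-valid (more {r} {e = e} {ms = ms} p) = subst (λ r → Valid r ms) (ℕ.+-suc e r) (encodes₁-valid p)
encodes₂-valid (close p) = encodes₁-valid p
encodes₂-valid (more {r} {a = a} {e} {ms = ms} p) = subst (λ r → Valid r ms) (ℕ.+-suc (a + e) r) (encodes₂-valid p)

encodes₀-nodes : ∀ {r t j n} {w : W 0 r t j} {ms : Vec Move n} → Encodes₀ w ms → nodes ms ≡ j
encodes₁-nodes : ∀ {r t j n e} {w : W 1 r t j} {ms : Vec Move n} → Encodes₁ w e ms → nodes ms ≡ j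
encodes₂-nodes : ∀ {r t j n a e} {w : W 2 r t j} {ms : Vec Move n} → Encodes₂ w a e ms → nodes ms ≡ j
encodes₀-nodes nil = refl
encodes₀-nodes (leaf p) = encodes₀-nodes p
encodes₀-nodes (node p) = cong suc (encodes₂-nodes p)
encodes₁-nodes (close p) = encodes₀-nodes p
encodes₁-nodes (more p) = encodes₁-nodes p
encodes₂-nodes (close p) = encodes₁-nodes p
encodes₂-nodes (more p) = encodes₂-nodes p

-- A `leaf` contributes to r, a `node` to j, and `more` only trades r for t. So r + t + j counts
-- leaves and nodes, one for each point.
encodes₀-length : ∀ {r t j n} {w : W 0 r t j} {ms : Vec Move n} → Encodes₀ w ms → n ≡ r + t + j
encodes₁-length : ∀ {r t j n e} {w : W 1 r t j} {ms : Vec Move n} → Encodes₁ w e ms → n ≡ r + t + j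
encodes₂-length : ∀ {r t j n a e} {w : W 2 r t j} {ms : Vec Move n} → Encodes₂ w a e ms → n ≡ r + t + j
encodes₀-length nil = refl
encodes₀-length (leaf p) = cong suc (encodes₀-length p)
encodes₀-length (node {r} {t} {j} p) = cong suc (trans (encodes₂-length p) (sym (ℕ.+-suc (r + t) j)))
encodes₁-length (close p) = encodes₀-length p
encodes₁-length (more {r} {t} {j} p) = trans (encodes₁-length p) (cong (_+ j) (sym (ℕ.+-suc r t)))
encodes₂-length (close p) = encodes₁-length p
encodes₂-length (more {r} {t} {j} p) = trans (encodes₂-length p) (cong (_+ j) (sym (ℕ.+-suc r t)))

encodes₀-functional : ∀ {r t j n} {w : W 0 r t j} {ms ms′ : Vec Move n} →
                      Encodes₀ w ms → Encodes₀ w ms′ → ms ≡ ms′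
encodes₁-functional : ∀ {r t j n e e′} {w : W 1 r t j} {ms ms′ : Vec Move n} →
                      Encodes₁ w e ms → Encodes₁ w e′ ms′ → e ≡ e′ × ms ≡ ms′
encodes₂-functional : ∀ {r t j n a a′ e e′} {w : W 2 r t j} {ms ms′ : Vec Move n} →
                      Encodes₂ w a e ms → Encodes₂ w a′ e′ ms′ → a ≡ a′ × e ≡ e′ × ms ≡ ms′
encodes₀-functional nil nil = refl
encodes₀-functional (leaf p) (leaf q) = cong (leaf ∷_) (encodes₀-functional p q)
encodes₀-functional (node p) (node q) with encodes₂-functional p q
... | refl , refl , refl = refl
encodes₁-functional (close p) (close q) = refl , encodes₀-functional p q
encodes₁-functional (more p) (more q) with encodes₁-functional p q
... | refl , refl = refl , refl
encodes₂-functional (close p) (close q) = refl , encodes₁-functional p q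
encodes₂-functional (more p) (more q) with encodes₂-functional p q
... | refl , refl , refl = refl , refl , refl

-- The number `t` of occurrences of `more` is an output; the number of points fixes it afterwards.
-- The equations on `r′` stand in for transports along `+-suc`.
decode₀ : ∀ {n r} {ms : Vec Move n} → Valid r ms → ∃[ t ] Σ (W 0 r t (nodes ms)) λ w → Encodes₀ w ms
decode₁ : ∀ {n r r′} {ms : Vec Move n} e → r′ ≡ e + r → Valid r′ ms → ∃[ t ] Σ (W 1 r t (nodes ms)) λ w → Encodes₁ w e ms
decode₂ : ∀ {n r r′} {ms : Vec Move n} a e → r′ ≡ a + e + r → Valid r′ ms → ∃[ t ] Σ (W 2 r t (nodes ms)) λ w → Encodes₂ w a e ms
decode₀ [] = _ , _ , nil
decode₀ (leaf v) with decode₀ v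
... | _ , _ , p = _ , _ , leaf p
decode₀ (node {a = a} {e} {r} v) with decode₂ a e (sym (ℕ.+-suc (a + e) r)) v
... | _ , _ , p = _ , _ , node p
decode₁ zero refl v with decode₀ v
... | _ , _ , p = _ , _ , close p
decode₁ {r = r} (suc e) eq v with decode₁ e (trans eq (sym (ℕ.+-suc e r))) v
... | _ , _ , p = _ , _ , more p
decode₂ zero e eq v with decode₁ e eq v
... | _ , _ , p = _ , _ , close p
decode₂ {r = r} (suc a) e eq v with decode₂ a e (trans eq (sym (ℕ.+-suc (a + e) r))) v
... | _ , _ , p = _ , _ , more p

-- The bijection between words and pairs

module _ (A : Setoid 0ℓ 0ℓ) {B : Set} where
  open Setoid A using (Carrier) renaming (_≈_ to _≈ᴬ_)

  -- Describing the bijection by a relation reduces both directions to existence and both inverse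
  -- laws to uniqueness, with no computation of one map after the other.
  relation⇒inverse : ∀ {ℓ} (_~_ : B → Carrier → Set ℓ) →
    (∀ a → Σ B λ b → b ~ a) → (∀ b → Σ Carrier λ a → b ~ a) →
    (∀ {a a′ b b′} → b ~ a → b′ ~ a′ → a ≈ᴬ a′ → b ≡ b′) →
    (∀ {a a′ b} → b ~ a → b ~ a′ → a ≈ᴬ a′) →
    Inverse A (setoid B)
  relation⇒inverse _~_ total onto inj uniq = record
    { to        = λ a → proj₁ (total a)
    ; from      = λ b → proj₁ (onto b)
    ; to-cong   = inj (proj₂ (total _)) (proj₂ (total _))
    ; from-cong = λ { refl → Setoid.refl A }
    ; inverse   = (λ {b} {a} eq → inj (proj₂ (total a)) (proj₂ (onto b)) eq)
                , (λ { {a} refl → uniq (proj₂ (onto (proj₁ (total a)))) (proj₂ (total a)) })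
    }

Represents : ∀ {t j} → W 1 1 t j → NC n → NC n → Set₁
Represents {n} w π ρ = ∃₂ λ g (ms : Vec Move n) → Encodes₁ w g ms × Models (g ∷ []) ms (equiv π) (equiv ρ)

size-singleton : ∀ g → size (g ∷ []) ≡ g + 1
size-singleton g = trans (cong suc (ℕ.+-identityʳ g)) (ℕ.+-comm 1 g)

represents-total : ∀ t j (π ρ : NC (suc (t + j))) → IsInterval π → HasHasseDistance π ρ (t + j) → ∣ π ∣ ≡ suc j →
                   Σ (W 1 1 t j) λ w → Represents w π ρ
represents-total t j π ρ int dist #π with distance⇒models π ρ int dist
... | g , ms , m , c with decode₁ g (size-singleton g) (models-valid c m)
...   | t′ , w , enc = unify w enc j-eq (ℕ.suc-injective (encodes₁-length enc))
  where
  j-eq : nodes ms ≡ j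
  j-eq = ℕ.suc-injective (trans (ℕ.+-comm 1 (nodes ms)) (trans (sym (models-#ˡ m)) (trans (sym (∣∣≡# π)) #π)))
  -- The decoded indices agree with `t` and `j` only up to provable equality, `j` by the number of
  -- blocks and `t` by the number of points; with variables in their place the equations can be
  -- matched.
  unify : ∀ {t′ j′} (w : W 1 1 t′ j′) → Encodes₁ w g ms → j′ ≡ j → t + j ≡ t′ + j′ → Σ (W 1 1 t j) λ w → Represents w π ρ
  unify {t′} w enc refl eq with ℕ.+-cancelʳ-≡ j t t′ eq
  ... | refl = w , g , ms , enc , m

represents-onto : ∀ {t j} (w : W 1 1 t j) → Σ (NC (suc (t + j))) λ π → Σ (NC (suc (t + j))) λ ρ →
  IsInterval π × HasHasseDistance π ρ (t + j) × ∣ π ∣ ≡ suc j × Represents w π ρ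
represents-onto w with encode₁ w
... | g , n , ms , enc with encodes₁-length enc
...   | refl with realise (g ∷ []) (size-singleton g) (encodes₁-valid enc)
...     | R , S , cv , m₀ = π , ρ , convex⇒interval π cvπ , models⇒distance π ρ cvπ m (valid-cycles (encodes₁-valid enc))
    , trans (∣∣≡# π) (trans (models-#ˡ m) (trans (ℕ.+-comm (nodes ms) 1) (cong suc (encodes₁-nodes enc))))
    , g , ms , enc , m
  where
  ncS : NonCrossing S
  ncS = links-nonCrossing (models-links m₀)
  ncR : NonCrossing R
  ncR a<b b<c c<d ac bd = cv (ℕ.<⇒≤ a<b) (ℕ.<⇒≤ b<c) ac
  π = fromEquiv R ncR
  ρ = fromEquiv S ncS
  cvπ : Convex (equiv π)
  cvπ a≤b b≤c ac = fromEquiv-⊒ R ncR (cv a≤b b≤c (fromEquiv-⊑ R ncR ac))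
  m : Models (g ∷ []) ms (equiv π) (equiv ρ)
  m = models-resp (fromEquiv-⊒ R ncR) (fromEquiv-⊑ R ncR) (fromEquiv-⊒ S ncS) (fromEquiv-⊑ S ncS) m₀

represents-injective : ∀ {t j} {w w′ : W 1 1 t j} (π ρ π′ ρ′ : NC n) → Represents w π ρ → Represents w′ π′ ρ′ →
                       π ≈ π′ → ρ ≈ ρ′ → w ≡ w′
represents-injective π ρ π′ ρ′ (g , ms , enc , m) (g′ , ms′ , enc′ , m′) π≈π′ ρ≈ρ′
  with models-injective (valid-cycles (encodes₁-valid enc)) (valid-cycles (encodes₁-valid enc′)) m m′
         (≈⇒⊑ π π′ π≈π′) (≈⇒⊒ π π′ π≈π′) (≈⇒⊑ ρ ρ′ ρ≈ρ′) (≈⇒⊒ ρ ρ′ ρ≈ρ′)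
... | refl , refl = encodes₁-injective enc enc′

represents-unique : ∀ {t j} {w : W 1 1 t j} (π ρ π′ ρ′ : NC n) → IsInterval π → IsInterval π′ →
                    Represents w π ρ → Represents w π′ ρ′ → π ≈ π′ × ρ ≈ ρ′
represents-unique π ρ π′ ρ′ int int′ (g , ms , enc , m) (g′ , ms′ , enc′ , m′) with encodes₁-functional enc enc′
... | refl , refl =
    ⊑-antisym π π′ (models-uniqueˡ (equiv-convex π int) (equiv-convex π′ int′) m m′)
                   (models-uniqueˡ (equiv-convex π′ int′) (equiv-convex π int) m′ m)
  , ⊑-antisym ρ ρ′ (links-unique (equiv ρ) (equiv ρ′) (models-links m) (models-links m′))
                   (links-unique (equiv ρ′) (equiv ρ) (models-links m′) (models-links m))

pairs-cardinality : ∀ t j → HasCardinality (M̅₁-withBlocks (suc (t + j)) (suc j)) (count 1 1 t j)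
pairs-cardinality t j = Composition.inverse
  (relation⇒inverse (M̅₁-withBlocks (suc (t + j)) (suc j)) (λ w (((π , ρ) , _) , _) → Represents w π ρ)
    (λ (((π , ρ) , int , dist) , #π) → represents-total t j π ρ int dist #π)
    (λ w → let (π , ρ , int , dist , #π , rep) = represents-onto w in (((π , ρ) , int , dist) , #π) , rep)
    (λ { {((π , ρ) , _) , _} {((π′ , ρ′) , _) , _} rep rep′ (eq , eq′) → represents-injective π ρ π′ ρ′ rep rep′ eq eq′ })
    (λ { {((π , ρ) , int , _) , _} {((π′ , ρ′) , int′ , _) , _} rep rep′ → represents-unique π ρ π′ ρ′ int int′ rep rep′ }))
  (W↔Fin 1 1 t j)

-- Rational terms and the sum over the numbers of blocks

ℕ→ℚ-+ : ∀ a b → ℕ→ℚ (a + b) ≡ ℕ→ℚ a ℚ.+ ℕ→ℚ b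
ℕ→ℚ-+ a b = ℚ.toℚᵘ-injective (begin
  toℚᵘ (ℕ→ℚ (a + b))                ≈⟨ ℚ.toℚᵘ-fromℚᵘ (mkℚᵘ (ℤ.+ (a + b)) 0) ⟩
  mkℚᵘ (ℤ.+ (a + b)) 0                ≈⟨ *≡* (cong (ℤ._* ℤ.+ 1) (cong₂ ℤ._+_ (sym (ℤ.*-identityʳ (ℤ.+ a))) (sym (ℤ.*-identityʳ (ℤ.+ b))))) ⟩
  mkℚᵘ (ℤ.+ a) 0 ℚᵘ.+ mkℚᵘ (ℤ.+ b) 0    ≈⟨ ℚᵘ.+-cong (ℚ.toℚᵘ-fromℚᵘ (mkℚᵘ (ℤ.+ a) 0)) (ℚ.toℚᵘ-fromℚᵘ (mkℚᵘ (ℤ.+ b) 0)) ⟨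
  toℚᵘ (ℕ→ℚ a) ℚᵘ.+ toℚᵘ (ℕ→ℚ b)    ≈⟨ ℚ.toℚᵘ-homo-+ (ℕ→ℚ a) (ℕ→ℚ b) ⟨
  toℚᵘ (ℕ→ℚ a ℚ.+ ℕ→ℚ b)            ∎)
  where open ℚᵘ.≃-Reasoning

ℕ→ℚ-quotient : ∀ n a b c → suc n * c ≡ a * b → ℕ→ℚ c ≡ (ℤ.+ 1 ℚ./ suc n) ℚ.* ℕ→ℚ a ℚ.* ℕ→ℚ b
ℕ→ℚ-quotient n a b c eq = ℚ.toℚᵘ-injective (begin
  toℚᵘ (ℕ→ℚ c)                                  ≈⟨ ℚ.toℚᵘ-fromℚᵘ (mkℚᵘ (ℤ.+ c) 0) ⟩
  mkℚᵘ (ℤ.+ c) 0                                  ≈⟨ *≡* cross ⟩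
  mkℚᵘ (ℤ.+ 1) n ℚᵘ.* mkℚᵘ (ℤ.+ a) 0 ℚᵘ.* mkℚᵘ (ℤ.+ b) 0
    ≈⟨ ℚᵘ.*-cong (ℚᵘ.*-cong (ℚ.toℚᵘ-fromℚᵘ (mkℚᵘ (ℤ.+ 1) n)) (ℚ.toℚᵘ-fromℚᵘ (mkℚᵘ (ℤ.+ a) 0))) (ℚ.toℚᵘ-fromℚᵘ (mkℚᵘ (ℤ.+ b) 0)) ⟨
  toℚᵘ (ℤ.+ 1 ℚ./ suc n) ℚᵘ.* toℚᵘ (ℕ→ℚ a) ℚᵘ.* toℚᵘ (ℕ→ℚ b)
    ≈⟨ ℚᵘ.*-congʳ {toℚᵘ (ℕ→ℚ b)} (ℚ.toℚᵘ-homo-* (ℤ.+ 1 ℚ./ suc n) (ℕ→ℚ a)) ⟨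
  toℚᵘ ((ℤ.+ 1 ℚ./ suc n) ℚ.* ℕ→ℚ a) ℚᵘ.* toℚᵘ (ℕ→ℚ b)
    ≈⟨ ℚ.toℚᵘ-homo-* ((ℤ.+ 1 ℚ./ suc n) ℚ.* ℕ→ℚ a) (ℕ→ℚ b) ⟨
  toℚᵘ ((ℤ.+ 1 ℚ./ suc n) ℚ.* ℕ→ℚ a ℚ.* ℕ→ℚ b)    ∎)
  where
  open ℚᵘ.≃-Reasoning
  cross : ℤ.+ c ℤ.* ℤ.+ (suc n * 1 * 1) ≡ ℤ.+ 1 ℤ.* ℤ.+ a ℤ.* ℤ.+ b ℤ.* ℤ.+ 1
  cross = trans (sym (ℤ.pos-* c (suc n * 1 * 1))) (trans
    (cong ℤ.+_ (trans (solve 2 (λ c n → c :* ((con 1 :+ n) :* con 1 :* con 1) := (con 1 :+ n) :* c) refl c n) eq))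
    (trans (ℤ.pos-* a b) (sym (trans (ℤ.*-identityʳ _) (cong (ℤ._* ℤ.+ b) (ℤ.*-identityˡ (ℤ.+ a)))))))

Fin-sum : ∀ n (k : Fin n → ℕ) → Σ (Fin n) (Fin ∘ k) ↔ Fin (sum ℕ.+-0-monoid k)
Fin-sum zero    k = mk↔ₛ′ (λ ()) (λ ()) (λ ()) (λ ())
Fin-sum (suc n) k = ↔-trans
  (mk↔ₛ′ (λ { (zero , x) → inj₁ x ; (suc i , x) → inj₂ (i , x) })
         (λ { (inj₁ x) → zero , x ; (inj₂ (i , x)) → suc i , x })
         (λ { (inj₁ x) → refl ; (inj₂ (i , x)) → refl })
         (λ { (zero , x) → refl ; (suc i , x) → refl }))
  (↔-trans (↔-refl ⊎-↔ Fin-sum n (k ∘ suc)) (↔-sym Fin.+↔⊎))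

module _ (A : Setoid 0ℓ 0ℓ) where
  open Setoid A using (Carrier) renaming (_≈_ to _≈ᴬ_)

  fibres-cardinality : (f : Carrier → ℕ) (n : ℕ) (k : Fin n → ℕ) →
    (∀ {a b} → a ≈ᴬ b → f a ≡ f b) → (∀ a → ∃[ i ] f a ≡ suc (toℕ {n} i)) →
    (∀ i → HasCardinality (Subsetoid A (λ a → f a ≡ suc (toℕ i))) (k i)) →
    HasCardinality A (sum ℕ.+-0-monoid k)
  fibres-cardinality f n k f-cong index card = Composition.inverse
    (relation⇒inverse A _~_
      (λ a → let (i , eq) = index a in (i , Inverse.to (card i) (a , eq)) , eq , refl)
      (λ (i , x) → let (a , eq) = Inverse.from (card i) x in a , eq , Inverse.strictlyInverseˡ (card i) x)
      inj uniq)
    (Fin-sum n k)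
    where
    _~_ : Σ (Fin n) (Fin ∘ k) → Carrier → Set
    (i , x) ~ a = Σ (f a ≡ suc (toℕ i)) λ eq → Inverse.to (card i) (a , eq) ≡ x
    inj : ∀ {a a′ b b′} → b ~ a → b′ ~ a′ → a ≈ᴬ a′ → b ≡ b′
    inj {b = i , _} {i′ , _} (eq , refl) (eq′ , refl) a≈a′
      with Fin.toℕ-injective (ℕ.suc-injective (trans (sym eq) (trans (f-cong a≈a′) eq′)))
    ... | refl = cong (i ,_) (Inverse.to-cong (card i) a≈a′)
    uniq : ∀ {a a′ b} → b ~ a → b ~ a′ → a ≈ᴬ a′
    uniq {a} {a′} {i , x} (eq , refl) (eq′ , same) =
      Setoid.trans A (Setoid.sym A (Inverse.strictlyInverseʳ (card i) (a , eq)))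
        (Setoid.trans A (Inverse.from-cong (card i) (sym same)) (Inverse.strictlyInverseʳ (card i) (a′ , eq′)))

-- Here n = t + j + 1, m = j + 1 and H = u (1 - u)⁻¹, so H′ = (1 - u)⁻². The weight is the
-- coefficient of uᵗ in (1 - u)⁻²ʲ⁻², that is C(t + 2j + 1, t).
count-term : ∀ t j → ℕ→ℚ (count 1 1 t j) ≡ term (suc (t + j)) (suc j)
count-term t j = ℕ→ℚ-quotient (t + j) (suc (t + j) C j) _ (count 1 1 t j)
  (trans (count-formula 1 1 t j) (cong ((suc (t + j) C j) *_) weight≡))
  where
  weight≡ : weight 1 1 t j ≡ (t + j + suc j) C (t + j ℕ.∸ j)
  weight≡ = trans (cong₂ _+_ (ℕ.*-identityˡ (multichoose (2 * j + 1) t)) (ℕ.*-identityˡ (multichoose⁻ (suc (2 * j + 1)) t)))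
    (trans (sym (multichoose-suc (2 * j + 1) t))
    (trans (multichoose-C (2 * j + 1) t)
    (cong₂ _C_ (solve 2 (λ t j → con 2 :* j :+ con 1 :+ t := t :+ j :+ (con 1 :+ j)) refl t j)
               (sym (ℕ.m+n∸n≡m t j)))))

blocks-cardinality : ∀ n j → j ≤ n → ∃[ k ] (HasCardinality (M̅₁-withBlocks (suc n) (suc j)) k × ℕ→ℚ k ≡ term (suc n) (suc j))
blocks-cardinality n j j≤n = subst
  (λ n → ∃[ k ] (HasCardinality (M̅₁-withBlocks (suc n) (suc j)) k × ℕ→ℚ k ≡ term (suc n) (suc j)))
  (ℕ.m∸n+n≡m j≤n) (count 1 1 (n ℕ.∸ j) j , pairs-cardinality (n ℕ.∸ j) j , count-term (n ℕ.∸ j) j)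

ℕ→ℚ-sum : ∀ n (k : Fin n → ℕ) → ℕ→ℚ (sum ℕ.+-0-monoid k) ≡ sum ℚ.+-0-monoid (ℕ→ℚ ∘ k)
ℕ→ℚ-sum zero    k = refl
ℕ→ℚ-sum (suc n) k = trans (ℕ→ℚ-+ (k zero) _) (cong (ℕ→ℚ (k zero) ℚ.+_) (ℕ→ℚ-sum n (k ∘ suc)))

∣∣-index : ∀ {n} (π : NC (suc n)) → ∃[ i ] ∣ π ∣ ≡ suc (toℕ {suc n} i)
∣∣-index {n} π with ∣ π ∣ in eq | subst (1 ≤_) (sym (∣∣≡# π)) (#-positive (equiv π)) | subst (_≤ suc n) (sym (∣∣≡# π)) (#-≤ (equiv π))
... | suc l | _ | l<n = fromℕ< l<n , cong suc (sym (Fin.toℕ-fromℕ< l<n))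

theorem1p1 : (n : ℕ) .{{_ : NonZero n}} →
    (∃[ k ] (HasCardinality (M̅₁ n) k × ℕ→ℚ k ≡ ∑term n)) ×
    (∀ m → 1 ≤ m → m ≤ n →
    ∃[ k ] (HasCardinality (M̅₁-withBlocks n m) k × ℕ→ℚ k ≡ term n m))
theorem1p1 zero    = contradiction refl (ℕ.≢-nonZero⁻¹ 0)
theorem1p1 (suc n) =
    ( sum ℕ.+-0-monoid card
    , fibres-cardinality (M̅₁ (suc n)) (λ ((π , _) , _) → ∣ π ∣) (suc n) card
        (λ { {(π , _) , _} {(π′ , _) , _} (π≈π′ , _) → ≈⇒∣∣≡ π π′ π≈π′ })
        (λ ((π , _) , _) → ∣∣-index π)
        (λ i → proj₁ (proj₂ (fibre i)))
    , trans (ℕ→ℚ-sum (suc n) card) (sum-cong-≗ ℚ.+-0-monoid (λ i → proj₂ (proj₂ (fibre i)))) )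
  , λ { (suc j) _ (s≤s j≤n) → blocks-cardinality n j j≤n }
  where
  fibre : (i : Fin (suc n)) → _
  fibre i = blocks-cardinality n (toℕ i) (ℕ.≤-pred (Fin.toℕ<n i))
  card : Fin (suc n) → ℕ
  card i = proj₁ (fibre i)
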